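{- For even $n\ge 2$ let $\mathcal P_n^{\mathrm{sq}}(z)$ be the partition function in $z$ of the strip of squares with $n$ black nodes on the torus. The recursion relation for it is $$\mathcal P_n^{\mathrm{sq}}(z)=\mathcal P_2^{\mathrm{sq}}(z)\,\mathcal P_{n-2}^{\mathrm{sq}}(z)-\mathcal P_{n-4}^{\mathrm{sq}}(z)$$ ($n\ge4$ even) with the initial conditions $$\mathcal P_0^{\mathrm{sq}}(z)=1,\qquad \mathcal P_2^{\mathrm{sq}}(z)=4-z-\frac1z.$$ The solution to this recursion is given by $$\mathcal P_n^{\mathrm{sq}}(z)=\frac{1}{(-4z)^{n/2}}\left[\left(z-1-\sqrt{1+z(z-6)}\right)^n+\left(z-1+\sqrt{1+z(z-6)}\right)^n\right].$$ This result is equivalent to $$\mathcal P_n^{\mathrm{sq}}(z)=z^{ -n/2}\sum_{p=0}^n(-1)^pz^p\sum_{q=0}^p\frac{n\,(n-q-1)!}{q!\,(p-q)!\,(n-q-p)!}$$ (terms with $q>n-p$ being read as $0$) and provides a closed form.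
   Context: Strip of squares. For even $n\ge2$, the strip of squares $\mathcal G_{2,n}$ on the torus is the multigraph with $2n$ nodes $(r,j)$, $r\in\mathbb Z/2$ (row; $r=0$ bottom, $r=1$ top), $j\in\mathbb Z/n$ (column). Node $(r,j)$ is black if $r+j$ is even and white otherwise, so there are $n$ black nodes. There are $4n$ distinct edges (parallel edges count as different): horizontal edges $h_{r,j}$ joining $(r,j)$ and $(r,j+1)$, and vertical edges $v_{r,j}$ joining $(r,j)$ and $(r+1,j)$, where $v_{r,j}$ is thought of as going upwards from $(r,j)$; thus $v_{0,j}$ is internal and $v_{1,j}$ crosses the cycle $z$ of the torus. Weights. A perfect matching is a set of edges touching each node exactly once. Edges are directed from black to white. The $z$-weight $n_z$ of a matching $M$ is the sum over edges $v_{1,j}\in M$ of $+1$ if $(1,j)$ is black and $-1$ if $(1,j)$ is white. The $w$-weight $n_w$ of $M$ is the sum over edges $h_{r,n-1}\in M$ (those crossing the cycle $w$) of $+1$ if $(r,n-1)$ is black and $-1$ if $(r,n-1)$ is white. The weight of $M$ is the pair $(n_z,n_w)$. Partition functions. The full partition function (Newton polynomial) is $\sum_{n_z,n_w}N_{n_z,n_w}(-1)^{n_z+n_w+n_zn_w}z^{n_z}w^{n_w}$, where $N_{n_z,n_w}$ is the number of perfect matchings of weight $(n_z,n_w)$. The partition function in $z$, $\mathcal P_n^{\mathrm{sq}}(z)$, is its $w^0$ part.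
   Formalization: The recursion is proved for even n ≥ 6, and at n = 4 with 2 in place of P_0 = 1 (in fact P_4 = P_2² − 2); the prefactor z^{ -n/2} of the last formula is corrected to (−z)^{ -n/2}, since as printed it gives −P_2 at n = 2. -}

module Defs where

open import Algebra.Bundles using (CommutativeRing)
open import Data.Empty using (⊥-elim)
open import Data.Fin.Base using (Fin; zero; suc; toℕ)
open import Data.Fin.Properties using (all?; nonZeroIndex)
import Data.Fin.Properties as Fin
open import Data.Integer.Base as ℤ using (ℤ; +_; -[1+_]; 0ℤ; 1ℤ; -1ℤ; ∣_∣)
import Data.Integer.Properties as ℤ
open import Data.List.Base
  using (List; []; _∷_; _++_; map; concatMap; filter; length; foldr; allFin)
open import Data.List.Properties using (filter-none; length-tabulate)
open import Data.List.Membership.Propositional using (_∈_)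
open import Data.List.Membership.Propositional.Properties
  using (∈-++⁻; ∈-map⁻; ∈-filter⁻)
open import Data.List.Relation.Unary.All using (tabulate)
open import Data.List.Relation.Unary.Any using (here)
open import Data.Nat.Base using (ℕ; zero; suc; _≤_; _<_; _∸_; _!; z≤n; s≤s)
import Data.Nat.Base as ℕ
open import Data.Nat.Combinatorics using (k![n∸k]!∣n!)
open import Data.Nat.Divisibility using (_∣_)
import Data.Nat.Divisibility as ∣
open import Data.Nat.DivMod using (_mod_; m/n*n≡m)
open import Data.Nat.ListAction using (sum)
import Data.Nat.Properties as ℕ
open import Data.Product using (_×_; _,_; proj₁)
open import Data.Product.Properties using (≡-dec)
open import Data.Sum.Base using (_⊎_; inj₁; inj₂)
open import Relation.Binary.PropositionalEquality
  using (_≡_; refl; sym; trans; cong; subst; subst₂)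
open import Relation.Nullary using (Dec; yes; no; ¬_)
open import Relation.Nullary.Decidable using (_×-dec_; _⊎-dec_)

-- i ↦ i + 1 in ℤ/k.
next : ∀ {k} → Fin k → Fin k
next {k} i = (suc (toℕ i) mod k) {{nonZeroIndex i}}

-- (r , j): row r (0 = bottom, 1 = top), column j.
Node : ℕ → Set
Node n = Fin 2 × Fin n

Black : ∀ {n} → Node n → Set
Black (r , j) = 2 ∣ (toℕ r ℕ.+ toℕ j)

black? : ∀ {n} (x : Node n) → Dec (Black x)
black? (r , j) = 2 ∣.∣? (toℕ r ℕ.+ toℕ j)

-- Parallel edges have different names, so they are distinct.
data Edge (n : ℕ) : Set where
  h v : Fin 2 → Fin n → Edge n

start end : ∀ {n} → Edge n → Node n
start (h r j) = r , j
start (v r j) = r , j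
end   (h r j) = r , next j
end   (v r j) = next r , j

-- Every edge of the strip, listed exactly once.
edges : ∀ n → List (Edge n)
edges n = concatMap column (allFin n)
  module Edges where
  column : Fin n → List (Edge n)
  column j = h zero j ∷ h (suc zero) j ∷ v zero j ∷ v (suc zero) j ∷ []

Touches : ∀ {n} → Node n → Edge n → Set
Touches x e = x ≡ start e ⊎ x ≡ end e

touches? : ∀ {n} (x : Node n) (e : Edge n) → Dec (Touches x e)
touches? x e = (x ≟ start e) ⊎-dec (x ≟ end e)
  where _≟_ = ≡-dec Fin._≟_ Fin._≟_

PerfectMatching : ∀ {n} → List (Edge n) → Set
PerfectMatching {n} M =
  (r : Fin 2) (j : Fin n) → length (filter (touches? (r , j)) M) ≡ 1

perfectMatching? : ∀ {n} (M : List (Edge n)) → Dec (PerfectMatching M)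
perfectMatching? M =
  all? λ r → all? λ j → length (filter (touches? (r , j)) M) ℕ.≟ 1

-- All sublists; for a list without repetitions this enumerates each set of
-- its elements exactly once.
sublists : ∀ {A : Set} → List A → List (List A)
sublists []       = [] ∷ []
sublists (x ∷ xs) = map (x ∷_) (sublists xs) ++ sublists xs

perfectMatchings : ∀ n → List (List (Edge n))
perfectMatchings n = filter perfectMatching? (sublists (edges n))

sign : ∀ {n} → Node n → ℤ
sign x with black? x
... | yes _ = 1ℤ
... | no  _ = -1ℤ

zWeight wWeight : ∀ {n} → Edge n → ℤ
zWeight (h r j)          = 0ℤ
zWeight (v zero j)       = 0ℤ
zWeight (v (suc zero) j) = sign (suc zero , j)

wWeight {n} (h r j) with suc (toℕ j) ℕ.≟ n
... | yes _ = sign (r , j)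
... | no  _ = 0ℤ
wWeight (v r j) = 0ℤ

total : ∀ {A : Set} → (A → ℤ) → List A → ℤ
total f = foldr (λ e s → f e ℤ.+ s) 0ℤ

HasWeight : ∀ {n} → ℤ → ℤ → List (Edge n) → Set
HasWeight a b M = total zWeight M ≡ a × total wWeight M ≡ b

hasWeight? : ∀ {n} a b (M : List (Edge n)) → Dec (HasWeight a b M)
hasWeight? a b M = (total zWeight M ℤ.≟ a) ×-dec (total wWeight M ℤ.≟ b)

N : ℕ → ℤ → ℤ → ℕ
N n a b = length (filter (hasWeight? a b) (perfectMatchings n))

-- The coefficient of z^a w^b in the Newton polynomial.  As (-1)^k depends only
-- on the parity of k, the absolute value of the exponent can be used.
newton : ℕ → ℤ → ℤ → ℤ
newton n a b = -1ℤ ℤ.^ ∣ a ℤ.+ b ℤ.+ a ℤ.* b ∣ ℤ.* + N n a b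

-- The coefficient of z^a in the w^0 part of the Newton polynomial.
partition : ℕ → ℤ → ℤ
partition n a = newton n a 0ℤ

module _ {A : Set} (f : A → ℤ) where
  ∣total∣≤ : ∀ xs {M} → M ∈ sublists xs →
             ∣ total f M ∣ ≤ sum (map (λ e → ∣ f e ∣) xs)
  ∣total∣≤ [] (here refl) = z≤n
  ∣total∣≤ (x ∷ xs) M∈ with ∈-++⁻ (map (x ∷_) (sublists xs)) M∈
  ... | inj₂ M∈xs = ℕ.≤-trans (∣total∣≤ xs M∈xs) (ℕ.m≤n+m _ ∣ f x ∣)
  ... | inj₁ M∈x∷ with ∈-map⁻ (x ∷_) M∈x∷
  ...   | M′ , M′∈xs , refl =
    ℕ.≤-trans (ℤ.∣i+j∣≤∣i∣+∣j∣ (f x) (total f M′))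
              (ℕ.+-monoʳ-≤ ∣ f x ∣ (∣total∣≤ xs M′∈xs))

∣sign∣≤1 : ∀ {n} (x : Node n) → ∣ sign x ∣ ≤ 1
∣sign∣≤1 x with black? x
... | yes _ = ℕ.≤-refl
... | no  _ = ℕ.≤-refl

edges-bound : ∀ {n} (js : List (Fin n)) →
  sum (map (λ e → ∣ zWeight e ∣) (concatMap (Edges.column n) js)) ≤ length js
edges-bound []       = z≤n
edges-bound (j ∷ js) = ℕ.+-mono-≤ (∣sign∣≤1 (suc zero , j)) (edges-bound js)

-- The exponents of z occurring in the partition function lie between -n and n,
-- so that the sum 𝒫 below runs over all of its terms.
partition-support : ∀ n a → n < ∣ a ∣ → partition n a ≡ 0ℤ
partition-support n a n<∣a∣ =
  trans (cong (λ k → -1ℤ ℤ.^ ∣ a ℤ.+ 0ℤ ℤ.+ a ℤ.* 0ℤ ∣ ℤ.* + k) N≡0)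
        (ℤ.*-zeroʳ (-1ℤ ℤ.^ ∣ a ℤ.+ 0ℤ ℤ.+ a ℤ.* 0ℤ ∣))
  where
  bound : ∀ {M} → M ∈ perfectMatchings n → ∣ total zWeight M ∣ ≤ n
  bound M∈ = ℕ.≤-trans
    (∣total∣≤ zWeight (edges n) (proj₁ (∈-filter⁻ perfectMatching? M∈)))
    (subst (sum (map (λ e → ∣ zWeight e ∣) (edges n)) ≤_)
           (length-tabulate (λ i → i)) (edges-bound (allFin n)))

  N≡0 : N n a 0ℤ ≡ 0
  N≡0 = cong length (filter-none (hasWeight? a 0ℤ) (tabulate λ M∈ (wt , _) →
    ℕ.<⇒≱ n<∣a∣ (subst (λ c → ∣ c ∣ ≤ n) wt (bound M∈))))

module _ {c ℓ} (R : CommutativeRing c ℓ) where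
  open CommutativeRing R
  open import Algebra.Properties.Semiring.Exp semiring using (_^_)
  open import Algebra.Properties.Semiring.Mult semiring
    using () renaming (_×_ to _·_)
  open import Algebra.Properties.Semiring.Sum semiring using (sum⁺-syntax)

  fromℤ : ℤ → Carrier
  fromℤ (+ k)    = k · 1#
  fromℤ -[1+ k ] = - (suc k · 1#)

  -- z^a for an element z with inverse z⁻¹.
  power : (z z⁻¹ : Carrier) → ℤ → Carrier
  power z z⁻¹ (+ k)    = z ^ k
  power z z⁻¹ -[1+ k ] = z⁻¹ ^ suc k

  -- The value of the partition function at z; the exponents are k - n.
  𝒫 : (z z⁻¹ : Carrier) → ℕ → Carrier
  𝒫 z z⁻¹ n = ∑[ k ≤ 2 ℕ.* n ]
    (fromℤ (partition n (toℕ k ℤ.⊖ n)) * power z z⁻¹ (toℕ k ℤ.⊖ n))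

denominator : ℕ → ℕ → ℕ → ℕ
denominator n p q = q ! ℕ.* (p ∸ q) ! ℕ.* (n ∸ q ∸ p) !

denominator≢0 : ∀ n p q → ℕ.NonZero (denominator n p q)
denominator≢0 n p q =
  ℕ.m*n≢0 _ _ {{q ℕ.!* (p ∸ q) !≢0}} {{(n ∸ q ∸ p) ℕ.!≢0}}

-- n (n-q-1)! / (q! (p-q)! (n-q-p)!), read as 0 when q > n - p.  The division
-- is exact, see summand-exact.
summand : ℕ → ℕ → ℕ → ℕ
summand n p q with (q ℕ.+ p) ℕ.≤? n
... | yes _ = ((n ℕ.* (n ∸ q ∸ 1) !) ℕ./ denominator n p q)
                {{denominator≢0 n p q}}
... | no  _ = 0

multinomial : ∀ a b c → a ! ℕ.* b ! ℕ.* c ! ∣ (a ℕ.+ b ℕ.+ c) !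
multinomial a b c = ∣.∣-trans
  (∣.*-monoˡ-∣ (c !) (binomial a b)) (binomial (a ℕ.+ b) c)
  where
  binomial : ∀ a b → a ! ℕ.* b ! ∣ (a ℕ.+ b) !
  binomial a b = subst (λ d → a ! ℕ.* d ! ∣ (a ℕ.+ b) !) (ℕ.m+n∸m≡n a b)
                       (k![n∸k]!∣n! (ℕ.m≤m+n a b))

-- q · m! is divisible by q! b! c! when q + b + c = m + 1.
shifted : ∀ q b c m → q ℕ.+ b ℕ.+ c ≡ suc m →
          q ! ℕ.* b ! ℕ.* c ! ∣ q ℕ.* m !
shifted zero    b c m eq = _ ∣.∣0
shifted (suc q) b c m eq = subst₂ _∣_
  (trans (sym (ℕ.*-assoc (suc q) (q ! ℕ.* b !) (c !)))
         (cong (ℕ._* c !) (sym (ℕ.*-assoc (suc q) (q !) (b !)))))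
  (cong (λ d → suc q ℕ.* d !) (ℕ.suc-injective eq))
  (∣.*-monoʳ-∣ (suc q) (multinomial q b c))

divides-numerator : ∀ n p q → 1 ≤ n → q ≤ p → q ℕ.+ p ≤ n →
                    denominator n p q ∣ n ℕ.* (n ∸ q ∸ 1) !
divides-numerator n p q 1≤n q≤p q+p≤n = go (n ∸ q) refl
  where
  q≤n : q ≤ n
  q≤n = ℕ.≤-trans (ℕ.m≤m+n q p) q+p≤n

  p≤n∸q : p ≤ n ∸ q
  p≤n∸q = ℕ.m+n≤o⇒m≤o∸n p (subst (_≤ n) (ℕ.+-comm q p) q+p≤n)

  parts : q ℕ.+ (p ∸ q) ℕ.+ (n ∸ q ∸ p) ≡ n ∸ q
  parts = trans (cong (ℕ._+ (n ∸ q ∸ p)) (ℕ.m+[n∸m]≡n q≤p))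
                (ℕ.m+[n∸m]≡n p≤n∸q)

  go : ∀ k → n ∸ q ≡ k → denominator n p q ∣ n ℕ.* (n ∸ q ∸ 1) !
  go zero eq = ⊥-elim (ℕ.<⇒≱ 1≤n
    (subst (_≤ 0) (ℕ.m+[n∸m]≡n q≤n)
      (subst (λ k → q ℕ.+ k ≤ 0) (sym eq)
        (subst (_≤ 0) (sym (ℕ.+-identityʳ q))
          (ℕ.≤-trans q≤p (subst (p ≤_) eq p≤n∸q))))))
  go (suc m) eq = subst (denominator n p q ∣_) split (∣.∣m∣n⇒∣m+n
    (shifted q (p ∸ q) (n ∸ q ∸ p) m (trans parts eq))
    (subst (λ d → denominator n p q ∣ d !) (trans parts eq)
      (multinomial q (p ∸ q) (n ∸ q ∸ p))))
    where
    split : q ℕ.* m ! ℕ.+ suc m ! ≡ n ℕ.* (n ∸ q ∸ 1) !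
    split = trans (sym (ℕ.*-distribʳ-+ (m !) q (suc m)))
      (trans (cong (λ d → (q ℕ.+ d) ℕ.* m !) (sym eq))
      (trans (cong (ℕ._* m !) (ℕ.m+[n∸m]≡n q≤n))
             (cong (λ d → n ℕ.* (d ∸ 1) !) (sym eq))))

summand-exact : ∀ n p q → 1 ≤ n → q ≤ p → q ℕ.+ p ≤ n →
                summand n p q ℕ.* denominator n p q ≡ n ℕ.* (n ∸ q ∸ 1) !
summand-exact n p q 1≤n q≤p q+p≤n with (q ℕ.+ p) ℕ.≤? n
... | yes _ = m/n*n≡m {{denominator≢0 n p q}} (divides-numerator n p q 1≤n q≤p q+p≤n)
... | no ≰n = ⊥-elim (≰n q+p≤n)

{-# OPTIONS --safe #-}
-- A perfect matching either alternates between the rows all around the strip, and then has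
-- w-weight 1 or -1, or it covers every column by a vertical edge or pairs it with a neighbour by two
-- parallel horizontal edges, and then has w-weight 0.  The matchings of w-weight 0 are thus counted
-- by a 2 × 2 transfer matrix.  A column with vertical edges contributes 1 - 1/z or 1 - z,
-- alternately, so that 𝒫 n is the trace of the (n/2)-th power of a matrix of determinant 1 and
-- trace 4 - z - 1/z; the recursion is Cayley-Hamilton.  The two other formulas satisfy the same
-- second-order recursion: the first one is a power sum of the eigenvalues.  For the second one,
-- n (n-q-1)! / (q! (p-q)! (n-q-p)!) is a sum of two trinomial coefficients, and Pascal's rule gives a
-- one-step recursion whose two-step form is the recursion above.
module Submission where

open import Defs
open import Algebra.Bundles using (CommutativeMonoid; CommutativeRing)
import Algebra.Properties.AbelianGroup as AbelianGroup
import Algebra.Properties.CommutativeMonoid.Sum as MonoidSum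
import Algebra.Properties.Semiring.Exp as Exp
import Algebra.Properties.Semiring.Sum as Sum
open import Data.Bool.Base using (Bool; true; false; if_then_else_; _∧_)
import Data.Bool.Properties as Bool
open import Data.Empty using (⊥-elim)
open import Data.Fin.Base using (Fin; zero; suc; toℕ; fromℕ; fromℕ<; inject₁)
import Data.Fin.Properties as Fin
open import Data.Fin.Properties
  using (toℕ-fromℕ<; toℕ-injective; toℕ-inject₁; toℕ-fromℕ; toℕ<n; nonZeroIndex)
open import Data.Fin.Relation.Unary.Top using (view; ‵fromℕ; ‵inject₁)
open import Data.Integer.Base as ℤ using (ℤ; -[1+_]; 0ℤ; 1ℤ; -1ℤ; ∣_∣; _⊖_) renaming (+_ to pos)
import Data.Integer.Properties as ℤ
open import Data.List.Base using (List; []; _∷_; _++_; map; concatMap; tabulate; filter; length)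
open import Data.List.Membership.Propositional using (_∈_)
open import Data.List.Properties using (length-tabulate)
open import Data.List.Relation.Unary.Any using (here; there)
open import Data.Nat.Base as ℕ using (ℕ; zero; suc; _≤_; _<_; _∸_; _/_; _!; z≤n; s≤s; s<s)
open import Data.Nat.Combinatorics
  using (_C_; k![n∸k]!∣n!; nCk≡n!/k![n-k]!; k>n⇒nCk≡0; nCk+nC[k+1]≡[n+1]C[k+1])
open import Data.Nat.Divisibility using (_∣_; divides; ∣m∣n⇒∣m+n; ∣-refl; _∣0)
open import Data.Nat.DivMod using (_%_; m<n⇒m%n≡m; n%n≡0; m%n<n; m/n*n≡m; m*n/n≡m)
import Data.Nat.ListAction as ListAction
import Data.Nat.Properties as ℕ
open import Data.Nat.Tactic.RingSolver using (solve-∀)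
open import Data.Product using (_×_; _,_; proj₁; proj₂; ∃)
open import Data.Sum.Base using (_⊎_; inj₁; inj₂; [_,_]′)
open import Data.Unit.Base using (⊤; tt)
open import Data.Vec.Base as Vec using (Vec; []; _∷_; lookup)
open import Data.Vec.Properties using (lookup-map)
open import Function.Base using (_∘_; id)
open import Function.Bundles using (_⇔_; mk⇔; module Equivalence)
open import Relation.Binary.PropositionalEquality as ≡ using (_≡_; _≢_; module ≡-Reasoning)
open import Relation.Nullary using (Dec; yes; no; ¬_; does)
open import Relation.Nullary.Decidable using (_×-dec_; dec-true; dec-false; does-⇔)
open import Relation.Unary using (Pred; Decidable)

-- The empty strip has just the empty matching, so `P 0` is 1, whereas the zeroth power of the
-- transfer matrix has trace 2. The recursion therefore holds as it stands only when all its indices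
-- are positive, that is from n = 6 on; at n = 4 the trace 2 takes the place of `P 0`. The prefactor
-- of the closed form is a power of -1/z for a similar reason: at n = 2 the double sum is 1 - 4z +
-- z², and dividing it by -z gives 4 - z - 1/z.
--
-- The obstacle is that 𝒫 counts sublists of all edges subject to a degree condition at every node,
-- which is not visibly a product. A sublist amounts to four bits per column, and the degree of a
-- node involves only its own column and the preceding one, so the condition becomes a chain of
-- local conditions. The chain is cyclic; it is cut open by starting it in the state in which it
-- ends.

module SumDelta {c ℓ} (M : CommutativeMonoid c ℓ) where
  open CommutativeMonoid M renaming (Carrier to C; trans to ≈-trans)
  open MonoidSum M

  sum-zero : ∀ {n} (t : Fin n → C) → (∀ i → t i ≈ ε) → sum t ≈ ε
  sum-zero {n} t t≈ε = ≈-trans (sum-cong-≋ t≈ε) (sum-replicate-zero n)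

  sum-single : ∀ {n} (t : Fin n → C) i → (∀ j → j ≢ i → t j ≈ ε) → sum t ≈ t i
  sum-single t zero    off =
    ≈-trans (∙-congˡ (sum-zero (t ∘ suc) λ j → off (suc j) λ ())) (identityʳ _)
  sum-single t (suc i) off = ≈-trans (∙-congʳ (off zero λ ())) (≈-trans (identityˡ _)
    (sum-single (t ∘ suc) i λ j j≢i → off (suc j) (j≢i ∘ Fin.suc-injective)))

-- Perfect matchings as cyclic chains of column states.

module Matchings where
  open ≡ using (refl; sym; trans; cong; cong₂; subst)
  open import Data.Integer.Base using (_+_)

  open MonoidSum ℤ.+-0-commutativeMonoid using (sum-cong-≗; ∑-distrib-+) renaming (sum to ∑)
  open SumDelta ℤ.+-0-commutativeMonoid using (sum-single)

  -- Defined by cases instead of modular arithmetic, it reduces in step with `lookup` on `states`,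
  -- as `lookup-prev` requires.
  prev : ∀ {k} → Fin k → Fin k
  prev {suc k} zero    = fromℕ k
  prev {suc k} (suc j) = inject₁ j

  private
    toℕ-next : ∀ {k} (i : Fin k) → toℕ (next i) ≡ (suc (toℕ i) % k) {{nonZeroIndex i}}
    toℕ-next {k} i = toℕ-fromℕ< (m%n<n (suc (toℕ i)) k {{nonZeroIndex i}})

  next-inject₁ : ∀ {k} (i : Fin k) → next (inject₁ i) ≡ suc i
  next-inject₁ {k} i = toℕ-injective (trans (toℕ-next (inject₁ i))
    (trans (cong (λ m → suc m % suc k) (toℕ-inject₁ i)) (m<n⇒m%n≡m (ℕ.s≤s (toℕ<n i)))))

  next-fromℕ : ∀ k → next (fromℕ k) ≡ zero
  next-fromℕ k = toℕ-injective (trans (toℕ-next (fromℕ k))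
    (trans (cong (λ m → suc m % suc k) (toℕ-fromℕ k)) (n%n≡0 (suc k))))

  next-prev : ∀ {k} (j : Fin k) → next (prev j) ≡ j
  next-prev {suc k} zero    = next-fromℕ k
  next-prev {suc k} (suc j) = next-inject₁ j

  prev-next : ∀ {k} (i : Fin k) → prev (next i) ≡ i
  prev-next {suc k} i with view i
  ... | ‵fromℕ     = cong prev (next-fromℕ k)
  ... | ‵inject₁ i = cong prev (next-inject₁ i)

  next≢ : ∀ {k} (i : Fin (suc (suc k))) → i ≢ next i
  next≢ {k} i with view i
  ... | ‵fromℕ     = λ eq → contra (trans eq (next-fromℕ (suc k)))
    where
    contra : fromℕ (suc k) ≢ zero
    contra ()
  ... | ‵inject₁ j = λ eq → ℕ.<⇒≢ ℕ.≤-refl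
    (trans (sym (toℕ-inject₁ j)) (cong toℕ (trans eq (next-inject₁ j))))

  -- The period 2 holds by computation, so in `walks-double` the parity hypotheses for `o` serve
  -- unchanged for `2 + o`.
  signℕ : ℕ → ℤ
  signℕ 0             = 1ℤ
  signℕ 1             = -1ℤ
  signℕ (suc (suc k)) = signℕ k

  sign-even : ∀ q → signℕ (q ℕ.* 2) ≡ 1ℤ
  sign-even zero    = refl
  sign-even (suc q) = sign-even q

  sign-odd : ∀ k → ¬ (2 ∣ k) → signℕ k ≡ -1ℤ
  sign-odd 0             odd = ⊥-elim (odd (2 ∣0))
  sign-odd 1             odd = refl
  sign-odd (suc (suc k)) odd = sign-odd k (odd ∘ ∣m∣n⇒∣m+n ∣-refl)

  sign≡signℕ : ∀ {n} (x : Node n) → sign x ≡ signℕ (toℕ (proj₁ x) ℕ.+ toℕ (proj₂ x))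
  sign≡signℕ x@(r , j) with black? x
  ... | yes (divides q eq) = sym (trans (cong signℕ eq) (sign-even q))
  ... | no  odd            = sym (sign-odd (toℕ r ℕ.+ toℕ j) odd)

  sign-alternates : ∀ k → (signℕ k ≡ 1ℤ × signℕ (suc k) ≡ -1ℤ) ⊎ (signℕ k ≡ -1ℤ × signℕ (suc k) ≡ 1ℤ)
  sign-alternates 0             = inj₁ (refl , refl)
  sign-alternates 1             = inj₂ (refl , refl)
  sign-alternates (suc (suc k)) = sign-alternates k

  -- Which of the edges h 0 j, h 1 j, v 0 j, v 1 j of a column belong to a set.
  record Choice : Set where
    constructor choice
    field h₀ h₁ v₀ v₁ : Bool
  open Choice

  pick : ∀ {A : Set} → Bool → A → List A → List A
  pick true  x xs = x ∷ xs
  pick false x xs = xs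

  select : ∀ {n k} → (Fin k → Fin n) → Vec Choice k → List (Edge n)
  select f []      = []
  select f (x ∷ c) =
    pick (h₀ x) (h zero (f zero)) (pick (h₁ x) (h (suc zero) (f zero))
      (pick (v₀ x) (v zero (f zero)) (pick (v₁ x) (v (suc zero) (f zero))
        (select (f ∘ suc) c))))

  on : Bool → ℤ → ℤ
  on b i = if b then i else 0ℤ

  weigh : Choice → (a b c d : ℤ) → ℤ
  weigh x a b c d = on (h₀ x) a + (on (h₁ x) b + (on (v₀ x) c + on (v₁ x) d))

  columnWeight : ∀ {n} → (Edge n → ℤ) → Fin n → Choice → ℤ
  columnWeight μ j x = weigh x (μ (h zero j)) (μ (h (suc zero) j)) (μ (v zero j)) (μ (v (suc zero) j))

  total-pick : ∀ {A : Set} (μ : A → ℤ) b x xs → total μ (pick b x xs) ≡ on b (μ x) + total μ xs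
  total-pick μ true  x xs = refl
  total-pick μ false x xs = sym (ℤ.+-identityˡ _)

  total-select : ∀ {n k} (μ : Edge n → ℤ) (f : Fin k → Fin n) c →
    total μ (select f c) ≡ ∑ (λ i → columnWeight μ (f i) (lookup c i))
  total-select μ f []      = refl
  total-select {n} μ f (x ∷ c) = begin
    total μ (select f (x ∷ c))
      ≡⟨ total-pick μ (h₀ x) _ _ ⟩
    _
      ≡⟨ cong (a +_) (trans (total-pick μ (h₁ x) _ _) (cong (b +_)
           (trans (total-pick μ (v₀ x) _ _) (cong (c′ +_) (total-pick μ (v₁ x) _ _))))) ⟩
    a + (b + (c′ + (d + t)))
      ≡⟨ cong (λ s → a + (b + s)) (ℤ.+-assoc c′ d t) ⟨
    a + (b + (c′ + d + t))
      ≡⟨ cong (a +_) (ℤ.+-assoc b (c′ + d) t) ⟨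
    a + (b + (c′ + d) + t)
      ≡⟨ ℤ.+-assoc a _ t ⟨
    columnWeight μ (f zero) x + t
      ≡⟨ cong (columnWeight μ (f zero) x +_) (total-select μ (f ∘ suc) c) ⟩
    ∑ (λ i → columnWeight μ (f i) (lookup (x ∷ c) i)) ∎
    where
    open ≡-Reasoning
    j = f zero
    a = on (h₀ x) (μ (h zero j))
    b = on (h₁ x) (μ (h (suc zero) j))
    c′ = on (v₀ x) (μ (v zero j))
    d = on (v₁ x) (μ (v (suc zero) j))
    t = total μ (select (f ∘ suc) c)

  indicator : ∀ {p} {P : Set p} → Dec P → ℤ
  indicator d = on (does d) 1ℤ

  length-filter : ∀ {A : Set} {p} {P : Pred A p} (P? : Decidable P) xs →
    pos (length (filter P? xs)) ≡ total (indicator ∘ P?) xs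
  length-filter P? []       = refl
  length-filter P? (x ∷ xs) with P? x
  ... | yes _ = cong (1ℤ +_) (length-filter P? xs)
  ... | no  _ = trans (length-filter P? xs) (sym (ℤ.+-identityˡ _))

  -- The horizontal edges leaving a column to the right.
  State : Set
  State = Bool × Bool

  state : Choice → State
  state x = h₀ x , h₁ x

  -- As there are only two rows, both vertical edges of a column join the same two nodes and count
  -- in either row.
  own : Fin 2 → Choice → ℤ
  own zero       x = weigh x 1ℤ 0ℤ 1ℤ 1ℤ
  own (suc zero) x = weigh x 0ℤ 1ℤ 1ℤ 1ℤ

  incoming : Fin 2 → State → ℤ
  incoming zero       (a , b) = on a 1ℤ
  incoming (suc zero) (a , b) = on b 1ℤ

  on-zero : ∀ b → on b 0ℤ ≡ 0ℤ
  on-zero true  = refl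
  on-zero false = refl

  weigh-h₀ : ∀ x i → weigh x i 0ℤ 0ℤ 0ℤ ≡ on (h₀ x) i
  weigh-h₀ x i = trans (cong (on (h₀ x) i +_) (cong₂ _+_ (on-zero (h₁ x))
    (cong₂ _+_ (on-zero (v₀ x)) (on-zero (v₁ x))))) (ℤ.+-identityʳ _)

  weigh-h₁ : ∀ x i → weigh x 0ℤ i 0ℤ 0ℤ ≡ on (h₁ x) i
  weigh-h₁ x i = trans (cong₂ _+_ (on-zero (h₀ x)) (cong (on (h₁ x) i +_)
    (cong₂ _+_ (on-zero (v₀ x)) (on-zero (v₁ x))))) (trans (ℤ.+-identityˡ _) (ℤ.+-identityʳ _))

  weigh-v₁ : ∀ x i → weigh x 0ℤ 0ℤ 0ℤ i ≡ on (v₁ x) i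
  weigh-v₁ x i = trans (cong₂ _+_ (on-zero (h₀ x)) (cong₂ _+_ (on-zero (h₁ x))
    (cong (_+ on (v₁ x) i) (on-zero (v₀ x)))))
    (trans (ℤ.+-identityˡ _) (trans (ℤ.+-identityˡ _) (ℤ.+-identityˡ _)))

  weigh-zero : ∀ x → weigh x 0ℤ 0ℤ 0ℤ 0ℤ ≡ 0ℤ
  weigh-zero x = trans (weigh-h₀ x 0ℤ) (on-zero (h₀ x))

  touching : ∀ {n} → Node n → Edge n → ℤ
  touching x e = indicator (touches? x e)

  -- The two contributions add up correctly because no horizontal edge is a loop, hence the two or
  -- more columns. With exactly two columns the horizontal edges of a row are parallel, but they
  -- belong to different columns and are counted separately.
  touching-column : ∀ {k} r (j i : Fin (suc (suc k))) x → columnWeight (touching (r , j)) i x ≡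
    on (does (j Fin.≟ i)) (own r x) + on (does (j Fin.≟ next i)) (incoming r (state x))
  touching-column zero j i x with j Fin.≟ i | j Fin.≟ next i
  ... | yes refl | yes j≡   = ⊥-elim (next≢ i j≡)
  ... | yes refl | no _     = sym (ℤ.+-identityʳ _)
  ... | no _     | yes refl = trans (weigh-h₀ x 1ℤ) (sym (ℤ.+-identityˡ _))
  ... | no _     | no _     = weigh-zero x
  touching-column (suc zero) j i x with j Fin.≟ i | j Fin.≟ next i
  ... | yes refl | yes j≡   = ⊥-elim (next≢ i j≡)
  ... | yes refl | no _     = sym (ℤ.+-identityʳ _)
  ... | no _     | yes refl = trans (weigh-h₁ x 1ℤ) (sym (ℤ.+-identityˡ _))
  ... | no _     | no _     = weigh-zero x

  -- Since `next` is a bijection with inverse `prev`, each of the two sums over columns has a single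
  -- term that can be nonzero.
  degree : ∀ {k} r (j : Fin (suc (suc k))) (c : Vec Choice (suc (suc k))) →
    total (touching (r , j)) (select id c) ≡
    own r (lookup c j) + incoming r (state (lookup c (prev j)))
  degree r j c = begin
    total (touching (r , j)) (select id c)
      ≡⟨ total-select (touching (r , j)) id c ⟩
    ∑ (λ i → columnWeight (touching (r , j)) i (lookup c i))
      ≡⟨ sum-cong-≗ (λ i → touching-column r j i (lookup c i)) ⟩
    ∑ (λ i → ownAt i + incomingAt i)
      ≡⟨ ∑-distrib-+ ownAt incomingAt ⟩
      ∑ ownAt + ∑ incomingAt
      ≡⟨ cong₂ _+_ (sum-single ownAt j own-off) (sum-single incomingAt (prev j) incoming-off) ⟩
    ownAt j + incomingAt (prev j)
      ≡⟨ cong₂ _+_ own-j incoming-prev ⟩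
    own r (lookup c j) + incoming r (state (lookup c (prev j))) ∎
    where
    open ≡-Reasoning
    ownAt incomingAt : Fin _ → ℤ
    ownAt i = on (does (j Fin.≟ i)) (own r (lookup c i))
    incomingAt i = on (does (j Fin.≟ next i)) (incoming r (state (lookup c i)))

    own-off : ∀ i → i ≢ j → ownAt i ≡ 0ℤ
    own-off i i≢j = cong (λ b → on b _) (dec-false (j Fin.≟ i) (i≢j ∘ sym))

    incoming-off : ∀ i → i ≢ prev j → incomingAt i ≡ 0ℤ
    incoming-off i i≢ = cong (λ b → on b _) (dec-false (j Fin.≟ next i)
      λ j≡ → i≢ (trans (sym (prev-next i)) (cong prev (sym j≡))))

    own-j : ownAt j ≡ own r (lookup c j)
    own-j = cong (λ b → on b (own r (lookup c j))) (dec-true (j Fin.≟ j) refl)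

    incoming-prev : incomingAt (prev j) ≡ incoming r (state (lookup c (prev j)))
    incoming-prev = cong (λ b → on b (incoming r (state (lookup c (prev j)))))
      (dec-true (j Fin.≟ next (prev j)) (sym (next-prev j)))

  Compatible : State → Choice → Set
  Compatible s x = ∀ r → own r x + incoming r s ≡ 1ℤ

  compatible? : ∀ s x → Dec (Compatible s x)
  compatible? s x = Fin.all? λ r → own r x + incoming r s ℤ.≟ 1ℤ

  Linked : ∀ {k} → State → Vec Choice k → Set
  Linked s []      = ⊤
  Linked s (x ∷ c) = Compatible s x × Linked (state x) c

  linked? : ∀ {k} s (c : Vec Choice k) → Dec (Linked s c)
  linked? s []      = yes tt
  linked? s (x ∷ c) = compatible? s x ×-dec linked? (state x) c

  final : ∀ {k} → State → Vec Choice k → State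
  final s []      = s
  final s (x ∷ c) = final (state x) c

  -- Entry `inject₁ j` is the state in which column `j` is entered, and the last entry is the state
  -- in which the chain ends.
  states : ∀ {k} → State → Vec Choice k → Vec State (suc k)
  states s c = s ∷ Vec.map state c

  linked⇔ : ∀ {k} s (c : Vec Choice k) →
    Linked s c ⇔ (∀ j → Compatible (lookup (states s c) (inject₁ j)) (lookup c j))
  linked⇔ s c = mk⇔ (to s c) (from s c)
    where
    to : ∀ {k} s (c : Vec Choice k) → Linked s c →
      ∀ j → Compatible (lookup (states s c) (inject₁ j)) (lookup c j)
    to s (x ∷ c) (ok , l) zero    = ok
    to s (x ∷ c) (ok , l) (suc j) = to (state x) c l j

    from : ∀ {k} s (c : Vec Choice k) →
      (∀ j → Compatible (lookup (states s c) (inject₁ j)) (lookup c j)) → Linked s c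
    from s []      ok = tt
    from s (x ∷ c) ok = ok zero , from (state x) c (ok ∘ suc)

  lookup-final : ∀ {k} s (c : Vec Choice k) → lookup (states s c) (fromℕ k) ≡ final s c
  lookup-final s []      = refl
  lookup-final s (x ∷ c) = lookup-final (state x) c

  lookup-prev : ∀ {k} s (c : Vec Choice (suc k)) j →
    lookup (states (final s c) c) (inject₁ j) ≡ state (lookup c (prev j))
  lookup-prev {k} s c zero = sym (trans (sym (lookup-map (fromℕ k) state c)) (lookup-final s c))
  lookup-prev s c (suc j) = lookup-map (inject₁ j) state c

  empty full : State
  empty = false , false
  full  = true , true

  -- For a nonempty `c` the value `final empty c` is the state of the last column; `empty` is a mere
  -- placeholder. Starting the chain there closes the cycle.
  perfectMatching⇔linked : ∀ {k} (c : Vec Choice (suc (suc k))) →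
    PerfectMatching (select id c) ⇔ Linked (final empty c) c
  perfectMatching⇔linked c = mk⇔ to from
    where
    open Equivalence (linked⇔ (final empty c) c) renaming (to to unlink; from to link)

    degree′ : ∀ r j → pos (length (filter (touches? (r , j)) (select id c))) ≡
      own r (lookup c j) + incoming r (lookup (states (final empty c) c) (inject₁ j))
    degree′ r j = trans (length-filter (touches? (r , j)) (select id c))
      (trans (degree r j c) (cong (λ s → own r (lookup c j) + incoming r s)
        (sym (lookup-prev empty c j))))

    to : PerfectMatching (select id c) → Linked (final empty c) c
    to pm = link λ j r → trans (sym (degree′ r j)) (cong pos (pm r j))

    from : Linked (final empty c) c → PerfectMatching (select id c)
    from l r j = ℤ.+-injective (trans (degree′ r j) (unlink l j r))

  -- o - 1 is the index of the first column, so that signℕ o is the colour of its top node.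
  z-exponent : ∀ {k} → ℕ → Vec Choice k → ℤ
  z-exponent o []      = 0ℤ
  z-exponent o (x ∷ c) = on (v₁ x) (signℕ o) + z-exponent (suc o) c

  total-zWeight : ∀ {n} (c : Vec Choice n) → total zWeight (select id c) ≡ z-exponent 1 c
  total-zWeight c = trans (total-select zWeight id c) (trans
    (sum-cong-≗ λ i → trans (weigh-v₁ (lookup c i) _) (cong (on (v₁ (lookup c i))) (sign≡signℕ (suc zero , i))))
    (columns 1 c))
    where
    columns : ∀ {k} o (c : Vec Choice k) →
      ∑ (λ i → on (v₁ (lookup c i)) (signℕ (o ℕ.+ toℕ i))) ≡ z-exponent o c
    columns o []      = refl
    columns o (x ∷ c) = cong₂ _+_ (cong (on (v₁ x) ∘ signℕ) (ℕ.+-identityʳ o))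
      (trans (sum-cong-≗ λ i → cong (on (v₁ (lookup c i)) ∘ signℕ) (ℕ.+-suc o (toℕ i)))
             (columns (suc o) c))

  wWeight-inner : ∀ {n} r (j : Fin n) → suc (toℕ j) ≢ n → wWeight (h r j) ≡ 0ℤ
  wWeight-inner {n} r j j≢ with suc (toℕ j) ℕ.≟ n
  ... | yes j≡ = ⊥-elim (j≢ j≡)
  ... | no _   = refl

  wWeight-outer : ∀ {n} r (j : Fin n) → suc (toℕ j) ≡ n → wWeight (h r j) ≡ signℕ (toℕ r ℕ.+ toℕ j)
  wWeight-outer {n} r j j≡ with suc (toℕ j) ℕ.≟ n
  ... | yes _ = sign≡signℕ (r , j)
  ... | no j≢ = ⊥-elim (j≢ j≡)

  total-wWeight : ∀ {k} (c : Vec Choice (suc k)) → total wWeight (select id c) ≡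
    on (proj₁ (final empty c)) (signℕ k) + on (proj₂ (final empty c)) (signℕ (suc k))
  total-wWeight {k} c = begin
    total wWeight (select id c)
      ≡⟨ total-select wWeight id c ⟩
    ∑ (λ i → columnWeight wWeight i (lookup c i))
      ≡⟨ sum-single _ (fromℕ k) inner ⟩
    columnWeight wWeight (fromℕ k) x
      ≡⟨ cong₂ _+_ (cong (on (h₀ x)) (trans (wWeight-outer zero (fromℕ k) last) (cong signℕ (toℕ-fromℕ k))))
           (trans (cong₂ _+_ (cong (on (h₁ x)) (trans (wWeight-outer (suc zero) (fromℕ k) last)
             (cong (signℕ ∘ suc) (toℕ-fromℕ k))))
             (cong₂ _+_ (on-zero (v₀ x)) (on-zero (v₁ x)))) (ℤ.+-identityʳ _)) ⟩
    on (h₀ x) (signℕ k) + on (h₁ x) (signℕ (suc k))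
      ≡⟨ cong (λ s → on (proj₁ s) (signℕ k) + on (proj₂ s) (signℕ (suc k)))
           (trans (sym (lookup-final empty c)) (lookup-map (fromℕ k) state c)) ⟨
    on (proj₁ (final empty c)) (signℕ k) + on (proj₂ (final empty c)) (signℕ (suc k)) ∎
    where
    open ≡-Reasoning
    x = lookup c (fromℕ k)

    last : suc (toℕ (fromℕ k)) ≡ suc k
    last = cong suc (toℕ-fromℕ k)

    inner : ∀ i → i ≢ fromℕ k → columnWeight wWeight i (lookup c i) ≡ 0ℤ
    inner i i≢ = trans (cong₂ (λ a b → weigh (lookup c i) a b 0ℤ 0ℤ)
      (wWeight-inner zero i i-inner) (wWeight-inner (suc zero) i i-inner)) (weigh-zero (lookup c i))
      where
      i-inner : suc (toℕ i) ≢ suc k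
      i-inner eq = i≢ (toℕ-injective (trans (ℕ.suc-injective eq) (sym (toℕ-fromℕ k))))

  balanced : State → Bool
  balanced (a , b) = does (a Bool.≟ b)

  on-opposite : ∀ s {a b} → (a ≡ 1ℤ × b ≡ -1ℤ) ⊎ (a ≡ -1ℤ × b ≡ 1ℤ) →
    does (on (proj₁ s) a + on (proj₂ s) b ℤ.≟ 0ℤ) ≡ balanced s
  on-opposite (true  , true ) (inj₁ (refl , refl)) = refl
  on-opposite (true  , true ) (inj₂ (refl , refl)) = refl
  on-opposite (true  , false) (inj₁ (refl , refl)) = refl
  on-opposite (true  , false) (inj₂ (refl , refl)) = refl
  on-opposite (false , true ) (inj₁ (refl , refl)) = refl
  on-opposite (false , true ) (inj₂ (refl , refl)) = refl
  on-opposite (false , false) _                    = refl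

  -- The two nodes of the last column have opposite colours, so its horizontal edges contribute with
  -- opposite signs and cancel exactly when both or neither are present.
  wWeight-balanced : ∀ {k} (c : Vec Choice (suc k)) →
    does (total wWeight (select id c) ℤ.≟ 0ℤ) ≡ balanced (final empty c)
  wWeight-balanced {k} c = trans (cong (λ i → does (i ℤ.≟ 0ℤ)) (total-wWeight c))
    (on-opposite (final empty c) (sign-alternates k))

  _==_ : State → State → Bool
  (a , b) == (c , d) = does (a Bool.≟ c) ∧ does (b Bool.≟ d)

-- Trinomial coefficients and the summand of the closed form.

module Trinomials where
  open ≡ using (refl; sym; trans; cong; cong₂; subst)
  open ≡-Reasoning
  open import Data.Nat.Base using (_+_; _*_)
  open import Data.Nat.Properties

  -- (n - q)! / (q! (p - q)! (n - q - p)!), which is 0 unless q ≤ p ≤ n - q.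
  trinomial : ℕ → ℕ → ℕ → ℕ
  trinomial n p q = ((n ∸ q) C p) * (p C q)

  C-factorial : ∀ {n k} → k ≤ n → (n C k) * (k ! * (n ∸ k) !) ≡ n !
  C-factorial {n} {k} k≤n = trans (cong (_* (k ! * (n ∸ k) !)) (nCk≡n!/k![n-k]! k≤n))
    (m/n*n≡m {{k !* (n ∸ k) !≢0}} (k![n∸k]!∣n! k≤n))

  C-C-factorial : ∀ {q p k} → q ≤ p → p ≤ k → (k C p) * (p C q) * (q ! * (p ∸ q) ! * (k ∸ p) !) ≡ k !
  C-C-factorial {q} {p} {k} q≤p p≤k = begin
    (k C p) * (p C q) * (q ! * (p ∸ q) ! * (k ∸ p) !)    ≡⟨ assoc (k C p) (p C q) (q ! * (p ∸ q) !) ((k ∸ p) !) ⟩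
    (k C p) * ((p C q) * (q ! * (p ∸ q) !) * (k ∸ p) !)  ≡⟨ cong (λ x → (k C p) * (x * (k ∸ p) !)) (C-factorial q≤p) ⟩
    (k C p) * (p ! * (k ∸ p) !)                          ≡⟨ C-factorial p≤k ⟩
    k !                                                  ∎
    where
    assoc : ∀ a b c d → a * b * (c * d) ≡ a * (b * c * d)
    assoc = solve-∀

  -- `trinomial n p q` counts the lattice paths from (0, 0) to (p, n - p) with unit steps along the
  -- axes and q diagonal steps. The three terms classify them by the last step; a diagonal step
  -- lowers n by 2.
  trinomial-pascal : ∀ n p q → trinomial (2 + n) (1 + p) (1 + q) ≡
    trinomial (1 + n) (1 + p) (1 + q) + trinomial (1 + n) p (1 + q) + trinomial n p q
  trinomial-pascal n p q with q ≤? n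
  ... | yes q≤n = begin
    ((1 + n ∸ q) C (1 + p)) * ((1 + p) C (1 + q))
      ≡⟨ cong (λ m → (m C (1 + p)) * ((1 + p) C (1 + q))) (+-∸-assoc 1 q≤n) ⟩
    ((1 + (n ∸ q)) C (1 + p)) * ((1 + p) C (1 + q))
      ≡⟨ cong (_* ((1 + p) C (1 + q))) (nCk+nC[k+1]≡[n+1]C[k+1] (n ∸ q) p) ⟨
    (((n ∸ q) C p) + ((n ∸ q) C (1 + p))) * ((1 + p) C (1 + q))
      ≡⟨ *-distribʳ-+ ((1 + p) C (1 + q)) ((n ∸ q) C p) ((n ∸ q) C (1 + p)) ⟩
    ((n ∸ q) C p) * ((1 + p) C (1 + q)) + y
      ≡⟨ cong (λ x → ((n ∸ q) C p) * x + y) (nCk+nC[k+1]≡[n+1]C[k+1] p q) ⟨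
    ((n ∸ q) C p) * ((p C q) + (p C (1 + q))) + y
      ≡⟨ expand ((n ∸ q) C p) (p C q) (p C (1 + q)) y ⟩
    y + ((n ∸ q) C p) * (p C (1 + q)) + ((n ∸ q) C p) * (p C q) ∎
    where
    y = ((n ∸ q) C (1 + p)) * ((1 + p) C (1 + q))
    expand : ∀ a b c y → a * (b + c) + y ≡ y + a * c + a * b
    expand = solve-∀
  trinomial-pascal n p zero | no q≰n = ⊥-elim (q≰n z≤n)
  -- Here the truncated differences are 0, and `0 C p` is nonzero only for p = 0, where the other
  -- binomial factor vanishes.
  trinomial-pascal n p (suc q) | no q≰n
    rewrite m≤n⇒m∸n≡0 (≰⇒> q≰n) | m≤n⇒m∸n≡0 (<⇒≤ (≰⇒> q≰n)) with p
  ... | zero  = refl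
  ... | suc p = refl

  trinomial-pascal₀ : ∀ n p → trinomial (1 + n) (1 + p) 0 ≡ trinomial n (1 + p) 0 + trinomial n p 0
  trinomial-pascal₀ n p = trans (*-identityʳ _) (trans (sym (nCk+nC[k+1]≡[n+1]C[k+1] n p))
    (trans (+-comm (n C p) (n C (1 + p))) (sym (cong₂ _+_ (*-identityʳ (n C (1 + p))) (*-identityʳ (n C p))))))

  trinomial-q>p : ∀ n {p q} → p < q → trinomial n p q ≡ 0
  trinomial-q>p n {p} {q} p<q = trans (cong (((n ∸ q) C p) *_) (k>n⇒nCk≡0 p<q)) (*-zeroʳ ((n ∸ q) C p))

  trinomial-vanishes : ∀ {n p q} → q ≤ p → n < q + p → trinomial n p q ≡ 0
  trinomial-vanishes {n} {zero}  {zero} q≤p ()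
  trinomial-vanishes {n} {suc p} {q}    q≤p n<q+p =
    cong (_* (suc p C q)) (k>n⇒nCk≡0 (m<n+o⇒m∸n<o n q n<q+p))

  -- These are the coefficients at p - 1 and q - 1. The explicit zeros stand for the index -1, where
  -- truncated subtraction would return the entry at 0.
  shifted-trinomial : ℕ → ℕ → ℕ → ℕ
  shifted-trinomial n p       zero    = 0
  shifted-trinomial n zero    (suc q) = 0
  shifted-trinomial n (suc p) (suc q) = trinomial n p q

  trinomial-denominator : ∀ {n p q} → q ≤ p → q + p ≤ n → trinomial n p q * denominator n p q ≡ (n ∸ q) !
  trinomial-denominator {n} {p} {q} q≤p q+p≤n =
    C-C-factorial q≤p (m+n≤o⇒m≤o∸n p (subst (_≤ n) (+-comm q p) q+p≤n))

  shifted-denominator : ∀ {n p q} → q ≤ p → q + p ≤ 2 + n →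
    shifted-trinomial n p q * denominator (2 + n) p q ≡ q * (2 + n ∸ q ∸ 1) !
  shifted-denominator {n} {p}     {zero}  q≤p       q+p≤n = refl
  shifted-denominator {n} {suc p} {suc q} (s≤s q≤p) q+p≤n = begin
    trinomial n p q * (suc q ! * (p ∸ q) ! * (1 + n ∸ q ∸ suc p) !)
      ≡⟨ cong (λ r → trinomial n p q * (suc q ! * (p ∸ q) ! * (r ∸ suc p) !)) 1+n∸q ⟩
    trinomial n p q * (suc q * q ! * (p ∸ q) ! * (n ∸ q ∸ p) !)
      ≡⟨ rearrange (trinomial n p q) (suc q) (q !) ((p ∸ q) !) ((n ∸ q ∸ p) !) ⟩
    suc q * (trinomial n p q * denominator n p q)
      ≡⟨ cong (suc q *_) (trinomial-denominator q≤p q+p≤n′) ⟩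
    suc q * (n ∸ q) !
      ≡⟨ cong (λ r → suc q * (r ∸ 1) !) 1+n∸q ⟨
    suc q * (1 + n ∸ q ∸ 1) ! ∎
    where
    q+p≤n′ : q + p ≤ n
    q+p≤n′ = ≤-pred (subst (_≤ suc n) (+-suc q p) (≤-pred q+p≤n))
    1+n∸q : 1 + n ∸ q ≡ suc (n ∸ q)
    1+n∸q = +-∸-assoc 1 (≤-trans (m≤m+n q p) q+p≤n′)
    rearrange : ∀ a b c d e → a * (b * c * d * e) ≡ b * (a * (c * d * e))
    rearrange = solve-∀

  shifted-vanishes : ∀ {n p q} → q ≤ p → 2 + n < q + p → shifted-trinomial n p q ≡ 0
  shifted-vanishes {q = zero} q≤p n<q+p = refl
  shifted-vanishes {n} {suc p} {suc q} (s≤s q≤p) (s<s n<q+p) =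
    trinomial-vanishes q≤p (≤-pred (subst (suc n <_) (+-suc q p) n<q+p))

  summand-zero : ∀ {n p q} → n < q + p → summand n p q ≡ 0
  summand-zero {n} {p} {q} n<q+p with q + p ≤? n
  ... | yes q+p≤n = ⊥-elim (<⇒≱ n<q+p q+p≤n)
  ... | no  _     = refl

  -- With N = 2 + n the numerator splits as N (N-q-1)! = (N-q)! + q (N-q-1)!, and each part is a
  -- trinomial times the denominator. Both sides are compared after multiplication by it.
  summand-trinomials : ∀ n {p q} → q ≤ p →
    summand (2 + n) p q ≡ trinomial (2 + n) p q + shifted-trinomial n p q
  summand-trinomials n {p} {q} q≤p = [ inside , outside ]′ (≤-<-connex (q + p) n′)
    where
    n′ : ℕ
    n′ = 2 + n

    outside : n′ < q + p → summand n′ p q ≡ trinomial n′ p q + shifted-trinomial n p q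
    outside n<q+p = trans (summand-zero {n′} {p} {q} n<q+p) (sym (cong₂ _+_
      (trinomial-vanishes {n′} {p} {q} q≤p n<q+p) (shifted-vanishes {n} {p} {q} q≤p n<q+p)))

    factorial : ∀ {k} → 0 < k → k * (k ∸ 1) ! ≡ k !
    factorial {suc k} _ = refl

    inside : q + p ≤ n′ → summand n′ p q ≡ trinomial n′ p q + shifted-trinomial n p q
    inside q+p≤n = *-cancelʳ-≡ (summand n′ p q) (trinomial n′ p q + shifted-trinomial n p q)
      (denominator n′ p q) {{denominator≢0 n′ p q}} (begin
      summand n′ p q * denominator n′ p q
        ≡⟨ summand-exact n′ p q (s≤s z≤n) q≤p q+p≤n ⟩
      n′ * (n′ ∸ q ∸ 1) !
        ≡⟨ cong (_* (n′ ∸ q ∸ 1) !) (m∸n+n≡m (<⇒≤ q<n)) ⟨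
      (n′ ∸ q + q) * (n′ ∸ q ∸ 1) !
        ≡⟨ *-distribʳ-+ ((n′ ∸ q ∸ 1) !) (n′ ∸ q) q ⟩
      (n′ ∸ q) * (n′ ∸ q ∸ 1) ! + q * (n′ ∸ q ∸ 1) !
        ≡⟨ cong₂ _+_ (factorial (m<n⇒0<n∸m q<n)) (sym (shifted-denominator {n} {p} {q} q≤p q+p≤n)) ⟩
      (n′ ∸ q) ! + shifted-trinomial n p q * denominator n′ p q
        ≡⟨ cong (_+ shifted-trinomial n p q * denominator n′ p q)
             (trinomial-denominator {n′} {p} {q} q≤p q+p≤n) ⟨
      trinomial n′ p q * denominator n′ p q + shifted-trinomial n p q * denominator n′ p q
        ≡⟨ *-distribʳ-+ (denominator n′ p q) (trinomial n′ p q) (shifted-trinomial n p q) ⟨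
      (trinomial n′ p q + shifted-trinomial n p q) * denominator n′ p q ∎)
      where
      q<n : q < n′
      -- Otherwise N ≤ q ≤ p, and q + p would be at least 2N. The strict inequality makes N - q
      -- positive, as (N-q) (N-q-1)! = (N-q)! demands.
      q<n = [ id , (λ n≤q → ⊥-elim (<⇒≱ (m<m+n n′ (s≤s z≤n))
        (≤-trans (+-mono-≤ n≤q (≤-trans n≤q q≤p)) q+p≤n))) ]′ (<-≤-connex q n′)

-- Exponents of z as summation indices.

⊖-cancelʳ : ∀ m m′ n → m ⊖ n ≡ m′ ⊖ n → m ≡ m′
⊖-cancelʳ m m′ n eq = ℤ.+-injective (AbelianGroup.∙-cancelʳ ℤ.+-0-abelianGroup (ℤ.- pos n) (pos m) (pos m′)
  (≡.trans (ℤ.m-n≡m⊖n m n) (≡.trans eq (≡.sym (ℤ.m-n≡m⊖n m′ n)))))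

exponent-index : ∀ n a → ∣ a ∣ ≤ n → ∃ λ (k : Fin (suc (2 ℕ.* n))) → toℕ k ⊖ n ≡ a
exponent-index n (pos m) m≤n =
  fromℕ< (s≤s m+n≤2n) , ≡.trans (≡.cong (_⊖ n) (toℕ-fromℕ< (s≤s m+n≤2n)))
    (≡.trans (ℤ.⊖-≥ (ℕ.m≤n+m n m)) (≡.cong pos (ℕ.m+n∸n≡m m n)))
  where
  m+n≤2n : m ℕ.+ n ≤ 2 ℕ.* n
  m+n≤2n = ℕ.+-mono-≤ m≤n (ℕ.m≤m+n n 0)
exponent-index n -[1+ m ] m<n =
  fromℕ< (s≤s n-m≤2n) , ≡.trans (≡.cong (_⊖ n) (toℕ-fromℕ< (s≤s n-m≤2n)))
    (≡.trans (ℤ.⊖-≤ (ℕ.m∸n≤m n (suc m))) (≡.cong (λ k → ℤ.- pos k) (ℕ.m∸[m∸n]≡n m<n)))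
  where
  n-m≤2n : n ∸ suc m ≤ 2 ℕ.* n
  n-m≤2n = ℕ.≤-trans (ℕ.m∸n≤m n (suc m)) (ℕ.m≤m+n n _)

∣zWeight∣≤ : ∀ n {M} → M ∈ sublists (edges n) → ∣ total zWeight M ∣ ≤ n
∣zWeight∣≤ n M∈ = ℕ.≤-trans (∣total∣≤ zWeight (edges n) M∈)
  (≡.subst (ListAction.sum (map (λ e → ∣ zWeight e ∣) (edges n)) ≤_)
    (length-tabulate {n = n} (λ i → i)) (edges-bound {n} (tabulate id)))

open Matchings
open Trinomials

-- Signs, powers and finite sums in a commutative ring.

module StripOfSquares {c ℓ} (R : CommutativeRing c ℓ) where
  open CommutativeRing R hiding (zero)
  open Exp semiring using (_^_; ^-homo-*)
  open Sum semiring using (sum-syntax; sum⁺-syntax; sum-cong-≋; ∑-distrib-+; *-distribˡ-sum)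
  open import Algebra.Properties.Semiring.Mult semiring using (×-homo-+) renaming (_×_ to _·_)
  open import Algebra.Properties.Semiring.Mult.TCOptimised semiring using (×ᵤ≈×) renaming (_×_ to _·′_)
  open import Algebra.Properties.Ring ring
    using (-1*x≈-x; -‿+-comm; -‿distribˡ-*; -‿distribʳ-*; +-cancelʳ; +-inverseˡ-unique; -0#≈0#)
    renaming (-‿involutive to neg-involutive)
  open import Algebra.Solver.Ring.NaturalCoefficients.Default commutativeSemiring
    using (solve; _:+_; _:*_; _:=_; con)
  open import Relation.Binary.Reasoning.Setoid setoid
  open SumDelta +-commutativeMonoid using (sum-zero; sum-single)

  *-interchange : ∀ a b c d → (a * b) * (c * d) ≈ (a * c) * (b * d)
  *-interchange = solve 4 (λ a b c d → (a :* b) :* (c :* d) := (a :* c) :* (b :* d)) refl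

  neg-^ : ∀ x k → (- x) ^ k ≈ (- 1#) ^ k * x ^ k
  neg-^ x zero    = sym (*-identityˡ 1#)
  neg-^ x (suc k) = begin
    - x * (- x) ^ k                    ≈⟨ *-cong (sym (-1*x≈-x x)) (neg-^ x k) ⟩
    (- 1# * x) * ((- 1#) ^ k * x ^ k)  ≈⟨ *-interchange _ _ _ _ ⟩
    (- 1# * (- 1#) ^ k) * (x * x ^ k)  ∎

  neg-*-neg : ∀ x y → - x * - y ≈ x * y
  neg-*-neg x y = begin
    - x * - y    ≈⟨ -‿distribˡ-* x (- y) ⟨
    - (x * - y)  ≈⟨ -‿cong (-‿distribʳ-* x y) ⟨
    - - (x * y)  ≈⟨ neg-involutive _ ⟩
    x * y        ∎

  fromℤ-neg : ∀ i → fromℤ R (ℤ.- i) ≈ - fromℤ R i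
  fromℤ-neg (pos zero)    = sym -0#≈0#
  fromℤ-neg (pos (suc k)) = refl
  fromℤ-neg -[1+ k ]      = sym (neg-involutive _)

  fromℤ-signed : ∀ k m → fromℤ R (-1ℤ ℤ.^ k ℤ.* pos m) ≈ (- 1#) ^ k * (m · 1#)
  fromℤ-signed zero    m = trans (reflexive (≡.cong (fromℤ R) (ℤ.*-identityˡ (pos m)))) (sym (*-identityˡ _))
  fromℤ-signed (suc k) m = begin
    fromℤ R (-1ℤ ℤ.* -1ℤ ℤ.^ k ℤ.* pos m)
      ≡⟨ ≡.cong (fromℤ R) (≡.trans (ℤ.*-assoc -1ℤ (-1ℤ ℤ.^ k) (pos m)) (ℤ.-1*i≡-i _)) ⟩
    fromℤ R (ℤ.- (-1ℤ ℤ.^ k ℤ.* pos m))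
      ≈⟨ fromℤ-neg (-1ℤ ℤ.^ k ℤ.* pos m) ⟩
    - fromℤ R (-1ℤ ℤ.^ k ℤ.* pos m)
      ≈⟨ -‿cong (fromℤ-signed k m) ⟩
    - ((- 1#) ^ k * (m · 1#))
      ≈⟨ -1*x≈-x _ ⟨
    - 1# * ((- 1#) ^ k * (m · 1#))
      ≈⟨ *-assoc _ _ _ ⟨
    (- 1#) ^ suc k * (m · 1#) ∎

  module _ {x y : Carrier} (xy≈1 : x * y ≈ 1#) where
    power-⊖ : ∀ m n → power R x y (m ⊖ n) ≈ x ^ m * y ^ n
    power-⊖ m       zero    = sym (*-identityʳ _)
    power-⊖ zero    (suc n) = sym (*-identityˡ _)
    power-⊖ (suc m) (suc n) = begin
      power R x y (suc m ⊖ suc n)    ≡⟨ ≡.cong (power R x y) (ℤ.[1+m]⊖[1+n]≡m⊖n m n) ⟩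
      power R x y (m ⊖ n)            ≈⟨ power-⊖ m n ⟩
      x ^ m * y ^ n                  ≈⟨ *-identityˡ _ ⟨
      1# * (x ^ m * y ^ n)           ≈⟨ *-congʳ xy≈1 ⟨
      (x * y) * (x ^ m * y ^ n)      ≈⟨ *-interchange _ _ _ _ ⟩
      (x * x ^ m) * (y * y ^ n)      ∎

    power-+ : ∀ a b → power R x y (a ℤ.+ b) ≈ power R x y a * power R x y b
    power-+ (pos m)  (pos n)  = ^-homo-* x m n
    power-+ (pos m)  -[1+ n ] = power-⊖ m (suc n)
    power-+ -[1+ m ] (pos n)  = trans (power-⊖ n (suc m)) (*-comm _ _)
    power-+ -[1+ m ] -[1+ n ] = trans (reflexive (≡.cong (λ k → y ^ suc k) (≡.sym (ℕ.+-suc m n))))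
      (^-homo-* y (suc m) (suc n))

  ∑ᴸ : ∀ {A : Set} → List A → (A → Carrier) → Carrier
  ∑ᴸ []       f = 0#
  ∑ᴸ (x ∷ xs) f = f x + ∑ᴸ xs f

  ∑ᴸ-cong : ∀ {A : Set} (xs : List A) {f g : A → Carrier} →
    (∀ {x} → x ∈ xs → f x ≈ g x) → ∑ᴸ xs f ≈ ∑ᴸ xs g
  ∑ᴸ-cong []       f≈g = refl
  ∑ᴸ-cong (x ∷ xs) f≈g = +-cong (f≈g (here ≡.refl)) (∑ᴸ-cong xs (f≈g ∘ there))

  ∑ᴸ-++ : ∀ {A : Set} (xs ys : List A) f → ∑ᴸ (xs ++ ys) f ≈ ∑ᴸ xs f + ∑ᴸ ys f
  ∑ᴸ-++ []       ys f = sym (+-identityˡ _)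
  ∑ᴸ-++ (x ∷ xs) ys f = trans (+-congˡ (∑ᴸ-++ xs ys f)) (sym (+-assoc _ _ _))

  ∑ᴸ-map : ∀ {A B : Set} (t : A → B) xs f → ∑ᴸ (map t xs) f ≈ ∑ᴸ xs (f ∘ t)
  ∑ᴸ-map t []       f = refl
  ∑ᴸ-map t (x ∷ xs) f = +-congˡ (∑ᴸ-map t xs f)

  ∑ᴸ-filter : ∀ {A : Set} {p} {P : Pred A p} (P? : Decidable P) xs f →
    ∑ᴸ (filter P? xs) f ≈ ∑ᴸ xs (λ x → if does (P? x) then f x else 0#)
  ∑ᴸ-filter P? []       f = refl
  ∑ᴸ-filter P? (x ∷ xs) f with does (P? x)
  ... | true  = +-congˡ (∑ᴸ-filter P? xs f)
  ... | false = trans (∑ᴸ-filter P? xs f) (sym (+-identityˡ _))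

  ∑ᴸ-const : ∀ {A : Set} (xs : List A) y → (length xs · 1#) * y ≈ ∑ᴸ xs (λ _ → y)
  ∑ᴸ-const []       y = zeroˡ y
  ∑ᴸ-const (x ∷ xs) y = trans (distribʳ y _ _) (+-cong (*-identityˡ y) (∑ᴸ-const xs y))

  ∑-∑ᴸ : ∀ {A : Set} {n} (xs : List A) (f : Fin n → A → Carrier) →
    ∑[ k < n ] ∑ᴸ xs (f k) ≈ ∑ᴸ xs (λ x → ∑[ k < n ] f k x)
  ∑-∑ᴸ {n = n} [] f = sum-zero {n} (λ _ → 0#) λ _ → refl
  ∑-∑ᴸ (x ∷ xs) f = trans (∑-distrib-+ (λ k → f k x) (λ k → ∑ᴸ xs (f k))) (+-congˡ (∑-∑ᴸ xs f))

  -- ∑² and ∑ᶜ are opaque so that the unifier can read off f from ∑² f and ∑ᶜ f.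
  opaque
    ∑² : (Bool → Carrier) → Carrier
    ∑² f = f true + f false

    ∑²-cong : ∀ {f g} → (∀ b → f b ≈ g b) → ∑² f ≈ ∑² g
    ∑²-cong f≈g = +-cong (f≈g true) (f≈g false)

    ∑²-+ : ∀ f g → ∑² (λ b → f b + g b) ≈ ∑² f + ∑² g
    ∑²-+ f g = solve 4 (λ a b c d → (a :+ b) :+ (c :+ d) := (a :+ c) :+ (b :+ d)) refl _ _ _ _

    ∑²-* : ∀ y f → ∑² (λ b → y * f b) ≈ y * ∑² f
    ∑²-* y f = sym (distribˡ y _ _)

    ∑-sublists-∷ : ∀ {A : Set} (x : A) xs f →
      ∑ᴸ (sublists (x ∷ xs)) f ≈ ∑² λ b → ∑ᴸ (sublists xs) (f ∘ pick b x)
    ∑-sublists-∷ x xs f = trans (∑ᴸ-++ (map (x ∷_) (sublists xs)) (sublists xs) f)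
      (+-congʳ (∑ᴸ-map (x ∷_) (sublists xs) f))

  opaque
    ∑ᶜ : (Choice → Carrier) → Carrier
    ∑ᶜ f = ∑² λ a → ∑² λ b → ∑² λ c → ∑² λ d → f (choice a b c d)

    ∑ᶜ-cong : ∀ {f g} → (∀ x → f x ≈ g x) → ∑ᶜ f ≈ ∑ᶜ g
    ∑ᶜ-cong f≈g = ∑²-cong λ a → ∑²-cong λ b → ∑²-cong λ c → ∑²-cong λ d → f≈g _

    ∑ᶜ-+ : ∀ f g → ∑ᶜ (λ x → f x + g x) ≈ ∑ᶜ f + ∑ᶜ g
    ∑ᶜ-+ f g = trans (∑²-cong λ a → trans (∑²-cong λ b →
      trans (∑²-cong λ c → ∑²-+ _ _) (∑²-+ _ _)) (∑²-+ _ _)) (∑²-+ _ _)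

    ∑ᶜ-* : ∀ y f → ∑ᶜ (λ x → y * f x) ≈ y * ∑ᶜ f
    ∑ᶜ-* y f = trans (∑²-cong λ a → trans (∑²-cong λ b →
      trans (∑²-cong λ c → ∑²-* _ _) (∑²-* _ _)) (∑²-* _ _)) (∑²-* _ _)

  ∑ⱽ : ∀ k → (Vec Choice k → Carrier) → Carrier
  ∑ⱽ zero    f = f []
  ∑ⱽ (suc k) f = ∑ᶜ λ x → ∑ⱽ k λ c → f (x ∷ c)

  ∑ⱽ-cong : ∀ k {f g} → (∀ c → f c ≈ g c) → ∑ⱽ k f ≈ ∑ⱽ k g
  ∑ⱽ-cong zero    f≈g = f≈g []
  ∑ⱽ-cong (suc k) f≈g = ∑ᶜ-cong λ x → ∑ⱽ-cong k λ c → f≈g (x ∷ c)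

  ∑ⱽ-+ : ∀ k f g → ∑ⱽ k (λ c → f c + g c) ≈ ∑ⱽ k f + ∑ⱽ k g
  ∑ⱽ-+ zero    f g = refl
  ∑ⱽ-+ (suc k) f g = trans (∑ᶜ-cong λ x → ∑ⱽ-+ k _ _) (∑ᶜ-+ _ _)

  ∑ⱽ-* : ∀ k y f → ∑ⱽ k (λ c → y * f c) ≈ y * ∑ⱽ k f
  ∑ⱽ-* zero    y f = refl
  ∑ⱽ-* (suc k) y f = trans (∑ᶜ-cong λ x → ∑ⱽ-* k y _) (∑ᶜ-* y _)

  ∑ⱽ-zero : ∀ k → ∑ⱽ k (λ _ → 0#) ≈ 0#
  ∑ⱽ-zero k = trans (∑ⱽ-cong k λ _ → sym (zeroˡ 0#)) (trans (∑ⱽ-* k 0# _) (zeroˡ _))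

  opaque
    unfolding ∑ᶜ

    -- The four edges of a column are peeled off one by one. The map `f` generalises `id`, so that
    -- the induction can pass to the remaining columns.
    ∑-select : ∀ {n k} (f : Fin k → Fin n) g →
      ∑ᴸ (sublists (concatMap (Edges.column n) (tabulate f))) g ≈ ∑ⱽ k (g ∘ select f)
    ∑-select {k = zero}  f g = +-identityʳ _
    ∑-select {n} {suc k} f g =
      trans (∑-sublists-∷ (h zero j) (h (suc zero) j ∷ v zero j ∷ v (suc zero) j ∷ es) g)
      (∑²-cong λ a → let g₁ = g ∘ pick a (h zero j) in
      trans (∑-sublists-∷ (h (suc zero) j) (v zero j ∷ v (suc zero) j ∷ es) g₁)
      (∑²-cong λ b → let g₂ = g₁ ∘ pick b (h (suc zero) j) in
      trans (∑-sublists-∷ (v zero j) (v (suc zero) j ∷ es) g₂)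
      (∑²-cong λ c → let g₃ = g₂ ∘ pick c (v zero j) in
      trans (∑-sublists-∷ (v (suc zero) j) es g₃)
      (∑²-cong λ d → ∑-select (f ∘ suc) (g₃ ∘ pick d (v (suc zero) j))))))
      where
      j : Fin n
      j = f zero

      es : List (Edge n)
      es = concatMap (Edges.column n) (tabulate (f ∘ suc))

  # : ℕ → Carrier
  # k = fromℤ R (pos k)

  #-+ : ∀ k l → # (k ℕ.+ l) ≈ # k + # l
  #-+ = ×-homo-+ 1#

  -- k ·′ 1# is the value of the solver's numeral con k; it is bracketed differently from # k.
  #≈×′ : ∀ k → # k ≈ k ·′ 1#
  #≈×′ k = ×ᵤ≈× k 1#

  -- Second-order recursions of determinant 1.

  x+y≈w⇒x≈w-y : ∀ {x y w} → x + y ≈ w → x ≈ w - y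
  x+y≈w⇒x≈w-y {x} {y} {w} x+y≈w = begin
    x              ≈⟨ +-identityʳ x ⟨
    x + 0#         ≈⟨ +-congˡ (-‿inverseʳ y) ⟨
    x + (y - y)    ≈⟨ +-assoc x y (- y) ⟨
    (x + y) - y    ≈⟨ +-congʳ x+y≈w ⟩
    w - y          ∎

  -- The determinant term stands on the left, so no subtraction occurs and the semiring solver can
  -- be applied.
  Recurrent : Carrier → (ℕ → Carrier) → Set ℓ
  Recurrent τ f = ∀ n → f (2 ℕ.+ n) + f n ≈ τ * f (1 ℕ.+ n)

  recurrent-unique : ∀ {τ f g} → Recurrent τ f → Recurrent τ g →
    f 0 ≈ g 0 → f 1 ≈ g 1 → ∀ n → f n ≈ g n × f (suc n) ≈ g (suc n)
  recurrent-unique rf rg f₀ f₁ zero    = f₀ , f₁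
  recurrent-unique {τ} {f} {g} rf rg f₀ f₁ (suc n) with recurrent-unique {τ} {f} {g} rf rg f₀ f₁ n
  ... | fₙ , fₙ₊₁ = fₙ₊₁ , +-cancelʳ (g n) _ _ (begin
    f (2 ℕ.+ n) + g n  ≈⟨ +-congˡ fₙ ⟨
    f (2 ℕ.+ n) + f n  ≈⟨ rf n ⟩
    τ * f (1 ℕ.+ n)    ≈⟨ *-congˡ fₙ₊₁ ⟩
    τ * g (1 ℕ.+ n)    ≈⟨ rg n ⟨
    g (2 ℕ.+ n) + g n  ∎)

  powerSum-recurrent : ∀ {a b τ} → a + b ≈ τ → a * b ≈ 1# → Recurrent τ (λ n → a ^ n + b ^ n)
  powerSum-recurrent {a} {b} {τ} a+b≈τ ab≈1 n = begin
    (a ^ (2 ℕ.+ n) + b ^ (2 ℕ.+ n)) + (a ^ n + b ^ n)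
      ≈⟨ +-congˡ (trans (*-congʳ ab≈1) (*-identityˡ _)) ⟨
    (a ^ (2 ℕ.+ n) + b ^ (2 ℕ.+ n)) + a * b * (a ^ n + b ^ n)
      ≈⟨ solve 4 (λ a b x y → (a :* (a :* x) :+ b :* (b :* y)) :+ a :* b :* (x :+ y)
                 := (a :+ b) :* (a :* x :+ b :* y)) refl a b (a ^ n) (b ^ n) ⟩
    (a + b) * (a ^ (1 ℕ.+ n) + b ^ (1 ℕ.+ n))
      ≈⟨ *-congʳ a+b≈τ ⟩
    τ * (a ^ (1 ℕ.+ n) + b ^ (1 ℕ.+ n)) ∎

  scaled-^ : ∀ u x n → (u * (x * x)) ^ n ≈ u ^ n * x ^ (n ℕ.* 2)
  scaled-^ u x zero    = sym (*-identityˡ 1#)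
  scaled-^ u x (suc n) = trans (*-congˡ (scaled-^ u x n))
    (solve 4 (λ u x v y → (u :* (x :* x)) :* (v :* y) := (u :* v) :* (x :* (x :* y)))
      refl u x (u ^ n) (x ^ (n ℕ.* 2)))

  -- Lucas polynomials and Delannoy numbers.

  module Lucas (m : Carrier) where
    -- The power sums of two quantities with sum 1 + m and product -m.
    lucas : ℕ → Carrier
    lucas 0             = 1# + 1#
    lucas 1             = 1# + m
    lucas (suc (suc n)) = (1# + m) * lucas (suc n) + m * lucas n

    -- The squares of these two quantities have sum (1 + m)² + 2m and product m².
    lucas-double : ∀ n → lucas (4 ℕ.+ n) + m * m * lucas n ≈
      (1# + (4 ·′ 1#) * m + m * m) * lucas (2 ℕ.+ n)
    lucas-double n = solve 3 (λ m x y →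
        let z = (con 1 :+ m) :* y :+ m :* x; w = (con 1 :+ m) :* z :+ m :* y in
        ((con 1 :+ m) :* w :+ m :* z) :+ m :* m :* x := (con 1 :+ con 4 :* m :+ m :* m) :* z)
      refl m (lucas n) (lucas (suc n))

    ∑≤ : ℕ → (ℕ → Carrier) → Carrier
    ∑≤ k f = ∑[ p ≤ k ] f (toℕ p)

    ∑≤-cong : ∀ k {f g} → (∀ p → p ≤ k → f p ≈ g p) → ∑≤ k f ≈ ∑≤ k g
    ∑≤-cong k f≈g = sum-cong-≋ {suc k} λ p → f≈g (toℕ p) (ℕ.≤-pred (toℕ<n p))

    ∑≤-+ : ∀ k f g → ∑≤ k (λ p → f p + g p) ≈ ∑≤ k f + ∑≤ k g
    ∑≤-+ k f g = ∑-distrib-+ {suc k} (f ∘ toℕ) (g ∘ toℕ)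

    ∑≤-last : ∀ k f → ∑≤ (suc k) f ≈ ∑≤ k f + f (suc k)
    ∑≤-last zero    f = solve 2 (λ x y → x :+ (y :+ con 0) := (x :+ con 0) :+ y) refl (f 0) (f 1)
    ∑≤-last (suc k) f = trans (+-congˡ (∑≤-last k (f ∘ suc))) (sym (+-assoc _ _ _))

    ∑≤-extend : ∀ k f → f (suc k) ≈ 0# → ∑≤ (suc k) f ≈ ∑≤ k f
    ∑≤-extend k f f≈0 = trans (∑≤-last k f) (trans (+-congˡ f≈0) (+-identityʳ _))

    eval : ℕ → (ℕ → Carrier) → Carrier
    eval k f = ∑≤ k λ p → m ^ p * f p

    eval-cong : ∀ k {f g} → (∀ p → f p ≈ g p) → eval k f ≈ eval k g
    eval-cong k {f} {g} f≈g =
      ∑≤-cong k {λ p → m ^ p * f p} {λ p → m ^ p * g p} λ p _ → *-congˡ (f≈g p)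

    eval-+ : ∀ k f g → eval k (λ p → f p + g p) ≈ eval k f + eval k g
    eval-+ k f g = trans (∑≤-cong k λ p _ → distribˡ (m ^ p) (f p) (g p))
      (∑≤-+ k (λ p → m ^ p * f p) (λ p → m ^ p * g p))

    eval-suc : ∀ k f → eval (suc k) f ≈ f 0 + m * eval k (f ∘ suc)
    eval-suc k f = +-cong (*-identityˡ (f 0)) (trans
      (∑≤-cong k {λ p → m ^ suc p * f (suc p)} λ p _ → *-assoc m (m ^ p) (f (suc p)))
      (sym (*-distribˡ-sum {suc k} m λ p → m ^ toℕ p * f (suc (toℕ p)))))

    eval-extend : ∀ k f → f (suc k) ≈ 0# → eval (suc k) f ≈ eval k f
    eval-extend k f f≈0 = ∑≤-extend k (λ p → m ^ p * f p) (trans (*-congˡ f≈0) (zeroʳ (m ^ suc k)))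

    -- For p ≤ n this is the Delannoy number of paths to (p, n - p), with any number of diagonal
    -- steps.
    row : ℕ → ℕ → Carrier
    row n p = ∑≤ p λ q → # (trinomial n p q)

    row-zero : ∀ n → row n 0 ≈ 1#
    row-zero n = trans (+-identityʳ _) (+-identityʳ _)

    row-vanishes : ∀ {n p} → n < p → row n p ≈ 0#
    row-vanishes {n} {p} n<p = trans
      (∑≤-cong p λ q q≤p → reflexive (≡.cong #
        (trinomial-vanishes {n} {p} {q} q≤p (ℕ.<-≤-trans n<p (ℕ.m≤n+m p q)))))
      (trans (∑≤-cong p λ q _ → sym (zeroˡ 0#)) (trans (sym (*-distribˡ-sum {suc p} 0# λ _ → 0#)) (zeroˡ _)))

    row-suc : ∀ n p → row (2 ℕ.+ n) (suc p) ≈ row (1 ℕ.+ n) (suc p) + row (1 ℕ.+ n) p + row n p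
    row-suc n p = begin
      # (trinomial (2 ℕ.+ n) (suc p) 0) + ∑≤ p (λ q → # (trinomial (2 ℕ.+ n) (suc p) (suc q)))
        ≈⟨ +-cong
             (trans (reflexive (≡.cong # (trinomial-pascal₀ (suc n) p)))
               (#-+ (trinomial (suc n) (suc p) 0) (trinomial (suc n) p 0)))
             (∑≤-cong p {g = λ q → f (suc q) + g (suc q) + k q} λ q _ →
               trans (reflexive (≡.cong # (trinomial-pascal n p q)))
               (trans (#-+ (trinomial (suc n) (suc p) (suc q) ℕ.+ trinomial (suc n) p (suc q)) (trinomial n p q))
                 (+-congʳ (#-+ (trinomial (suc n) (suc p) (suc q)) (trinomial (suc n) p (suc q)))))) ⟩
      (a + b) + ∑≤ p (λ q → f (suc q) + g (suc q) + k q)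
        ≈⟨ +-congˡ (trans (∑≤-+ p (λ q → f (suc q) + g (suc q)) k) (+-congʳ (∑≤-+ p (f ∘ suc) (g ∘ suc)))) ⟩
      (a + b) + (∑≤ p (f ∘ suc) + ∑≤ p (g ∘ suc) + ∑≤ p k)
        ≈⟨ solve 5 (λ a b x y z → (a :+ b) :+ (x :+ y :+ z) := (a :+ x) :+ (b :+ y) :+ z) refl a b _ _ _ ⟩
      row (1 ℕ.+ n) (suc p) + ∑≤ (suc p) g + row n p
        -- The middle sum runs one index too far, up to q = p + 1, where the coefficient vanishes.
        ≈⟨ +-congʳ (+-congˡ (∑≤-extend p g (reflexive (≡.cong # (trinomial-q>p (suc n) {p} ℕ.≤-refl))))) ⟩
      row (1 ℕ.+ n) (suc p) + row (1 ℕ.+ n) p + row n p ∎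
      where
      f g k : ℕ → Carrier
      f q = # (trinomial (suc n) (suc p) q)
      g q = # (trinomial (suc n) p q)
      k q = # (trinomial n p q)
      a b : Carrier
      a = f 0
      b = g 0

    delannoy : ℕ → Carrier
    delannoy n = eval n (row n)

    -- This is `row-suc` summed against powers of m: the two terms in which p drops by one acquire a
    -- factor m. Entries with p > n vanish, which reconciles the different summation ranges.
    delannoy-suc : ∀ n → delannoy (2 ℕ.+ n) ≈ (1# + m) * delannoy (1 ℕ.+ n) + m * delannoy n
    delannoy-suc n = begin
      delannoy (2 ℕ.+ n)
        ≈⟨ eval-suc (suc n) (row (2 ℕ.+ n)) ⟩
      row (2 ℕ.+ n) 0 + m * eval (suc n) (row (2 ℕ.+ n) ∘ suc)
        ≈⟨ +-cong (trans (row-zero (2 ℕ.+ n)) (sym (row-zero (1 ℕ.+ n)))) (*-congˡ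
             (trans (eval-cong (suc n) (row-suc n))
             (trans (eval-+ (suc n) (λ p → row (1 ℕ.+ n) (suc p) + row (1 ℕ.+ n) p) (row n))
               (+-congʳ (eval-+ (suc n) (row (1 ℕ.+ n) ∘ suc) (row (1 ℕ.+ n))))))) ⟩
      x + m * (y + z + w)
        ≈⟨ solve 5 (λ m x y z w → x :+ m :* (y :+ z :+ w) := (x :+ m :* y) :+ m :* z :+ m :* w) refl m x y z w ⟩
      (x + m * y) + m * z + m * w
        ≈⟨ +-cong (+-congʳ (trans (sym (eval-suc (suc n) (row (1 ℕ.+ n))))
               (eval-extend (suc n) (row (1 ℕ.+ n)) (row-vanishes {suc n} ℕ.≤-refl))))
             (*-congˡ (eval-extend n (row n) (row-vanishes {n} ℕ.≤-refl))) ⟩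
      z + m * z + m * delannoy n
        ≈⟨ solve 3 (λ m z u → z :+ m :* z :+ m :* u := (con 1 :+ m) :* z :+ m :* u) refl m z (delannoy n) ⟩
      (1# + m) * z + m * delannoy n ∎
      where
      x y z w : Carrier
      x = row (1 ℕ.+ n) 0
      y = eval (suc n) (row (1 ℕ.+ n) ∘ suc)
      z = delannoy (1 ℕ.+ n)
      w = eval (suc n) (row n)

    summandRow : ℕ → ℕ → Carrier
    summandRow n p = ∑≤ p λ q → # (summand n p q)

    summandRow-zero : ∀ n → summandRow (2 ℕ.+ n) 0 ≈ row (2 ℕ.+ n) 0
    summandRow-zero n = +-congʳ (reflexive (≡.cong # 
      (≡.trans (summand-trinomials n {0} {0} z≤n) (ℕ.+-identityʳ _))))

    summandRow-suc : ∀ n p → summandRow (2 ℕ.+ n) (suc p) ≈ row (2 ℕ.+ n) (suc p) + row n p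
    summandRow-suc n p = trans (∑≤-cong (suc p) λ q q≤p →
        trans (reflexive (≡.cong # (summand-trinomials n {suc p} {q} q≤p))) (#-+ (trinomial (2 ℕ.+ n) (suc p) q) _))
      (trans (∑≤-+ (suc p) (λ q → # (trinomial (2 ℕ.+ n) (suc p) q)) λ q → # (shifted-trinomial n (suc p) q))
        (+-congˡ (+-identityˡ _)))

    closed-form : ℕ → Carrier
    closed-form n = eval n (summandRow n)

    closed-form-delannoy : ∀ n → closed-form (2 ℕ.+ n) ≈ delannoy (2 ℕ.+ n) + m * delannoy n
    closed-form-delannoy n = begin
      closed-form (2 ℕ.+ n)
        ≈⟨ eval-suc (suc n) (summandRow (2 ℕ.+ n)) ⟩
      summandRow (2 ℕ.+ n) 0 + m * eval (suc n) (summandRow (2 ℕ.+ n) ∘ suc)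
        ≈⟨ +-cong (summandRow-zero n) (*-congˡ (trans (eval-cong (suc n) (summandRow-suc n))
             (eval-+ (suc n) (row (2 ℕ.+ n) ∘ suc) (row n)))) ⟩
      x + m * (y + eval (suc n) (row n))
        ≈⟨ +-congˡ (*-congˡ (+-congˡ (eval-extend n (row n) (row-vanishes {n} ℕ.≤-refl)))) ⟩
      x + m * (y + delannoy n)
        ≈⟨ solve 4 (λ m x y z → x :+ m :* (y :+ z) := (x :+ m :* y) :+ m :* z) refl m x y (delannoy n) ⟩
      (x + m * y) + m * delannoy n
        ≈⟨ +-congʳ (eval-suc (suc n) (row (2 ℕ.+ n))) ⟨
      delannoy (2 ℕ.+ n) + m * delannoy n ∎
      where
      x y : Carrier
      x = row (2 ℕ.+ n) 0
      y = eval (suc n) (row (2 ℕ.+ n) ∘ suc)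

    delannoy-0 : delannoy 0 ≈ 1#
    delannoy-0 = solve 0 (con 1 :* ((con 1 :+ con 0) :+ con 0) :+ con 0 := con 1) refl

    delannoy-1 : delannoy 1 ≈ 1# + m
    delannoy-1 = solve 1 (λ m → con 1 :* ((con 1 :+ con 0) :+ con 0) :+
      ((m :* con 1) :* ((con 1 :+ con 0) :+ (con 0 :+ con 0)) :+ con 0) := con 1 :+ m) refl m

    delannoy-2 : delannoy 2 ≈ (1# + m) * (1# + m) + m * 1#
    delannoy-2 = trans (delannoy-suc 0) (+-cong (*-congˡ delannoy-1) (*-congˡ delannoy-0))

    -- The analogue of expressing Lucas numbers as sums of two Fibonacci numbers two places apart.
    -- Both sides obey the same recursion, so two consecutive cases carry the induction.
    delannoy-lucas : ∀ n → delannoy (2 ℕ.+ n) + m * delannoy n ≈ lucas (2 ℕ.+ n) ×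
                           delannoy (3 ℕ.+ n) + m * delannoy (1 ℕ.+ n) ≈ lucas (3 ℕ.+ n)
    delannoy-lucas zero =
      trans (+-cong delannoy-2 (*-congˡ delannoy-0))
        (solve 1 (λ m → let x = con 1 :+ m in (x :* x :+ m :* con 1) :+ m :* con 1
          := x :* x :+ m :* (con 1 :+ con 1)) refl m) ,
      trans (+-cong (trans (delannoy-suc 1) (+-cong (*-congˡ delannoy-2) (*-congˡ delannoy-1)))
          (*-congˡ delannoy-1))
        (solve 1 (λ m → let x = con 1 :+ m in (x :* (x :* x :+ m :* con 1) :+ m :* x) :+ m :* x
          := x :* (x :* x :+ m :* (con 1 :+ con 1)) :+ m :* x) refl m)
    delannoy-lucas (suc n) with delannoy-lucas n
    ... | lₙ , lₙ₊₁ = lₙ₊₁ , (begin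
      delannoy (4 ℕ.+ n) + m * delannoy (2 ℕ.+ n)
        ≈⟨ +-cong (delannoy-suc (2 ℕ.+ n)) (*-congˡ (delannoy-suc n)) ⟩
      ((1# + m) * delannoy (3 ℕ.+ n) + m * delannoy (2 ℕ.+ n)) + m * ((1# + m) * delannoy (1 ℕ.+ n) + m * delannoy n)
        ≈⟨ solve 5 (λ m a b c e → let x = con 1 :+ m in (x :* a :+ m :* b) :+ m :* (x :* c :+ m :* e)
             := x :* (a :+ m :* c) :+ m :* (b :+ m :* e)) refl m _ _ _ _ ⟩
      (1# + m) * (delannoy (3 ℕ.+ n) + m * delannoy (1 ℕ.+ n)) + m * (delannoy (2 ℕ.+ n) + m * delannoy n)
        ≈⟨ +-cong (*-congˡ lₙ₊₁) (*-congˡ lₙ) ⟩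
      lucas (4 ℕ.+ n) ∎)

    closed-form-lucas : ∀ n → closed-form (2 ℕ.+ n) ≈ lucas (2 ℕ.+ n)
    closed-form-lucas n = trans (closed-form-delannoy n) (proj₁ (delannoy-lucas n))

  -- From the partition function to the transfer matrix.

  module Evaluation (z z⁻¹ : Carrier) (zz⁻¹≈1 : z * z⁻¹ ≈ 1#) where
    open Lucas (- z) using (lucas; lucas-double; closed-form; closed-form-lucas; ∑≤-cong; summandRow)

    -- Passing from z to - z absorbs the sign of the Newton polynomial.
    weight : ℤ → Carrier
    weight = power R (- z) (- z⁻¹)

    weight-+ : ∀ a b → weight (a ℤ.+ b) ≈ weight a * weight b
    weight-+ = power-+ (trans (neg-*-neg z z⁻¹) zz⁻¹≈1)

    signed-power : ∀ a → (- 1#) ^ ∣ a ∣ * power R z z⁻¹ a ≈ weight a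
    signed-power (pos k)  = sym (neg-^ z k)
    signed-power -[1+ k ] = sym (neg-^ z⁻¹ (suc k))

    contribution : ∀ {n} → List (Edge n) → Carrier
    contribution M = if does (perfectMatching? M) ∧ does (total wWeight M ℤ.≟ 0ℤ)
                     then weight (total zWeight M) else 0#

    term : ∀ n → ℤ → List (Edge n) → Carrier
    term n a M = if does (perfectMatching? M)
                 then (if does (hasWeight? a 0ℤ M) then weight a else 0#) else 0#

    coefficient : ∀ n a → fromℤ R (partition n a) * power R z z⁻¹ a ≈ ∑ᴸ (sublists (edges n)) (term n a)
    coefficient n a = begin
      fromℤ R (partition n a) * power R z z⁻¹ a
        ≈⟨ *-congʳ (fromℤ-signed ∣ a ℤ.+ 0ℤ ℤ.+ a ℤ.* 0ℤ ∣ (N n a 0ℤ)) ⟩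
      (- 1#) ^ ∣ a ℤ.+ 0ℤ ℤ.+ a ℤ.* 0ℤ ∣ * (N n a 0ℤ · 1#) * power R z z⁻¹ a
        ≡⟨ ≡.cong (λ b → (- 1#) ^ ∣ b ∣ * (N n a 0ℤ · 1#) * power R z z⁻¹ a)
             (≡.trans (≡.cong₂ ℤ._+_ (ℤ.+-identityʳ a) (ℤ.*-zeroʳ a)) (ℤ.+-identityʳ a)) ⟩
      (- 1#) ^ ∣ a ∣ * (N n a 0ℤ · 1#) * power R z z⁻¹ a
        ≈⟨ solve 3 (λ x y z → (x :* y) :* z := y :* (x :* z)) refl _ _ _ ⟩
      (N n a 0ℤ · 1#) * ((- 1#) ^ ∣ a ∣ * power R z z⁻¹ a)
        ≈⟨ *-congˡ (signed-power a) ⟩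
      (N n a 0ℤ · 1#) * weight a
        ≈⟨ ∑ᴸ-const (filter (hasWeight? a 0ℤ) (perfectMatchings n)) (weight a) ⟩
      ∑ᴸ (filter (hasWeight? a 0ℤ) (perfectMatchings n)) (λ _ → weight a)
        ≈⟨ ∑ᴸ-filter (hasWeight? a 0ℤ) (perfectMatchings n) _ ⟩
      ∑ᴸ (perfectMatchings n) (λ M → if does (hasWeight? a 0ℤ M) then weight a else 0#)
        ≈⟨ ∑ᴸ-filter perfectMatching? (sublists (edges n)) _ ⟩
      ∑ᴸ (sublists (edges n)) (term n a) ∎

    -- A matching of w-weight 0 is counted at exactly one exponent, its own z-weight; the bound on
    -- z-weights puts that exponent within the range of the sum.
    ∑-term : ∀ n {M} → M ∈ sublists (edges n) →
      ∑[ k ≤ 2 ℕ.* n ] term n (toℕ k ⊖ n) M ≈ contribution M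
    ∑-term n {M} M∈ with does (perfectMatching? M) | does (total wWeight M ℤ.≟ 0ℤ)
    ... | false | _     = sum-zero {suc (2 ℕ.* n)} (λ _ → 0#) λ _ → refl
    ... | true  | false = sum-zero {suc (2 ℕ.* n)}
      (λ k → if does (total zWeight M ℤ.≟ toℕ k ⊖ n) ∧ false then weight (toℕ k ⊖ n) else 0#)
      λ k → reflexive
      (≡.cong (λ b → if b then weight (toℕ k ⊖ n) else 0#) (Bool.∧-zeroʳ (does (total zWeight M ℤ.≟ toℕ k ⊖ n))))
    ... | true  | true  with exponent-index n (total zWeight M) (∣zWeight∣≤ n M∈)
    ...   | k , k≡ = trans (sum-single t k off) (reflexive (≡.trans
      (≡.cong (λ b → if b then weight (toℕ k ⊖ n) else 0#) (≡.cong (_∧ true)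
        (dec-true (total zWeight M ℤ.≟ toℕ k ⊖ n) (≡.sym k≡))))
      (≡.cong weight k≡)))
      where
      t : Fin (suc (2 ℕ.* n)) → Carrier
      t k = if does (total zWeight M ℤ.≟ toℕ k ⊖ n) ∧ true then weight (toℕ k ⊖ n) else 0#

      off : ∀ j → j ≢ k → t j ≈ 0#
      off j j≢k = reflexive (≡.cong (λ b → if b then weight (toℕ j ⊖ n) else 0#) (≡.cong (_∧ true)
        (dec-false (total zWeight M ℤ.≟ toℕ j ⊖ n)
          λ eq → j≢k (toℕ-injective (⊖-cancelʳ (toℕ j) (toℕ k) n (≡.sym (≡.trans k≡ eq)))))))

    𝒫-contributions : ∀ n → 𝒫 R z z⁻¹ n ≈ ∑ⱽ n (contribution ∘ select id)
    𝒫-contributions n = begin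
      𝒫 R z z⁻¹ n
        ≈⟨ sum-cong-≋ {suc (2 ℕ.* n)} (λ k → coefficient n (toℕ k ⊖ n)) ⟩
      ∑[ k ≤ 2 ℕ.* n ] ∑ᴸ (sublists (edges n)) (term n (toℕ k ⊖ n))
        ≈⟨ ∑-∑ᴸ {n = suc (2 ℕ.* n)} (sublists (edges n)) (λ k → term n (toℕ k ⊖ n)) ⟩
      ∑ᴸ (sublists (edges n)) (λ M → ∑[ k ≤ 2 ℕ.* n ] term n (toℕ k ⊖ n) M)
        ≈⟨ ∑ᴸ-cong (sublists (edges n)) (∑-term n) ⟩
      ∑ᴸ (sublists (edges n)) contribution
        ≈⟨ ∑-select {n} id contribution ⟩
      ∑ⱽ n (contribution ∘ select id) ∎

    walk : ∀ {k} → ℕ → State → State → Vec Choice k → Carrier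
    walk o s t c = if does (linked? s c) ∧ (final s c == t) then weight (z-exponent o c) else 0#

    -- The entry (`s`, `t`) of a product of `k` one-column transfer matrices, the parity of `o`
    -- deciding which of the two kinds comes first.
    walks : ℕ → State → State → ℕ → Carrier
    walks o s t k = ∑ⱽ k (walk o s t)

    if-∧false : ∀ b y → (if b ∧ false then y else 0#) ≈ 0#
    if-∧false true  y = refl
    if-∧false false y = refl

    -- A w-weight of 0 means that the last column has both of its horizontal edges or none.
    closed-walks : ∀ {k} (c : Vec Choice (suc (suc k))) →
      contribution (select id c) ≈ walk 1 empty empty c + walk 1 full full c
    closed-walks c@(x ∷ c′) = trans (reflexive (≡.cong₂ (λ b a → if b then a else 0#)
        (≡.cong₂ _∧_ (does-⇔ (perfectMatching⇔linked c) (perfectMatching? (select id c)) (linked? (final empty c) c))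
          (wWeight-balanced c))
        (≡.cong weight (total-zWeight c)))) (split (final (state x) c′) (weight (z-exponent 1 c)))
      where
      split : ∀ s y → (if does (linked? s c) ∧ balanced s then y else 0#) ≈
        (if does (linked? empty c) ∧ (s == empty) then y else 0#) +
        (if does (linked? full c) ∧ (s == full) then y else 0#)
      split (true  , true ) y = sym (trans (+-congʳ (if-∧false (does (linked? empty c)) y)) (+-identityˡ _))
      split (true  , false) y = sym (trans
        (+-cong (if-∧false (does (linked? empty c)) y) (if-∧false (does (linked? full c)) y))
        (trans (+-identityˡ 0#) (sym (if-∧false (does (linked? (true , false) c)) y))))
      split (false , true ) y = sym (trans
        (+-cong (if-∧false (does (linked? empty c)) y) (if-∧false (does (linked? full c)) y))
        (trans (+-identityˡ 0#) (sym (if-∧false (does (linked? (false , true) c)) y))))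
      split (false , false) y = sym (trans (+-congˡ (if-∧false (does (linked? full c)) y)) (+-identityʳ _))

    walks-suc : ∀ o s t k → walks o s t (suc k) ≈ ∑ᶜ λ x →
      if does (compatible? s x) then weight (on (Choice.v₁ x) (signℕ o)) * walks (suc o) (state x) t k else 0#
    walks-suc o s t k = ∑ᶜ-cong first
      where
      first : ∀ x → ∑ⱽ k (λ c → walk o s t (x ∷ c)) ≈
        (if does (compatible? s x) then weight (on (Choice.v₁ x) (signℕ o)) * walks (suc o) (state x) t k else 0#)
      first x with does (compatible? s x)
      ... | false = ∑ⱽ-zero k
      ... | true  = trans (∑ⱽ-cong k rest) (∑ⱽ-* k _ _)
        where
        rest : ∀ c → (if does (linked? (state x) c) ∧ (final (state x) c == t)
            then weight (on (Choice.v₁ x) (signℕ o) ℤ.+ z-exponent (suc o) c) else 0#) ≈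
            weight (on (Choice.v₁ x) (signℕ o)) * walk (suc o) (state x) t c
        rest c with does (linked? (state x) c) ∧ (final (state x) c == t)
        ... | true  = weight-+ (on (Choice.v₁ x) (signℕ o)) (z-exponent (suc o) c)
        ... | false = sym (zeroʳ _)

    opaque
      unfolding ∑² ∑ᶜ

      -- Compatibility with a balanced state forces the same horizontal choice in both rows, so the
      -- two unbalanced states are never reached and a 2 × 2 matrix suffices.
      walks-empty : ∀ o t k → walks o empty t (suc k) ≈
        (1# + weight (signℕ o)) * walks (suc o) empty t k + walks (suc o) full t k
      walks-empty o t k = trans (walks-suc o empty t k)
        -- The sixteen choices of `h₀`, `h₁`, `v₀`, `v₁`, presence before absence. The survivors are
        -- both horizontal edges (`b`), `v₀` alone (`a`) and `v₁` alone (`w :* a`).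
        (solve 3 (λ a b w → let O = con 0 in
                            (((O :+ O) :+ (O :+ con 1 :* b)) :+ ((O :+ O) :+ (O :+ O))) :+
                            (((O :+ O) :+ (O :+ O)) :+ ((O :+ con 1 :* a) :+ (w :* a :+ O)))
                          := (con 1 :+ w) :* a :+ b)
               refl (walks (suc o) empty t k) (walks (suc o) full t k) (weight (signℕ o)))

      walks-full : ∀ o t k → walks o full t (suc k) ≈ walks (suc o) empty t k
      walks-full o t k = trans (walks-suc o full t k)
        (solve 1 (λ a → let O = con 0 in
                        (((O :+ O) :+ (O :+ O)) :+ ((O :+ O) :+ (O :+ O))) :+
                        (((O :+ O) :+ (O :+ O)) :+ ((O :+ O) :+ (O :+ con 1 :* a))) := a)
               refl (walks (suc o) empty t k))

    -- In terms of m and i the identities are free of subtraction: a semiring solver suffices.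
    m i : Carrier
    m = - z
    i = - z⁻¹

    mi≈1 : m * i ≈ 1#
    mi≈1 = trans (neg-*-neg z z⁻¹) zz⁻¹≈1

    P : ℕ → Carrier
    P = 𝒫 R z z⁻¹

    -- The entries of T ^ n (a , b), where T is the transfer matrix of two columns.
    emptyEntry fullEntry : Carrier → Carrier → ℕ → Carrier
    emptyEntry a b zero    = a
    emptyEntry a b (suc n) = ((1# + i) * (1# + m) + 1#) * emptyEntry a b n + (1# + i) * fullEntry a b n
    fullEntry a b zero     = b
    fullEntry a b (suc n)  = (1# + m) * emptyEntry a b n + fullEntry a b n

    -- Walks of length 0 do not depend on the offset, so the initial vector can be written with
    -- offset 0.
    walks-double : ∀ n o t → signℕ o ≡ -1ℤ → signℕ (suc o) ≡ 1ℤ →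
      walks o empty t (n ℕ.* 2) ≈ emptyEntry (walks 0 empty t 0) (walks 0 full t 0) n ×
      walks o full  t (n ℕ.* 2) ≈ fullEntry (walks 0 empty t 0) (walks 0 full t 0) n
    walks-double zero    o t odd even = refl , refl
    walks-double (suc n) o t odd even with walks-double n (2 ℕ.+ o) t odd even
    ... | ihₑ , ihf =
      (begin
        walks o empty t (2 ℕ.+ k)
          ≈⟨ walks-empty o t (suc k) ⟩
        (1# + weight (signℕ o)) * walks (suc o) empty t (suc k) + walks (suc o) full t (suc k)
          ≈⟨ +-cong (*-cong (+-congˡ weight-odd) step₁) (walks-full (suc o) t k) ⟩
        (1# + i) * ((1# + m) * x + y) + x
          ≈⟨ solve 4 (λ i m x y → (con 1 :+ i) :* ((con 1 :+ m) :* x :+ y) :+ x :=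
               ((con 1 :+ i) :* (con 1 :+ m) :+ con 1) :* x :+ (con 1 :+ i) :* y) refl i m x y ⟩
        ((1# + i) * (1# + m) + 1#) * x + (1# + i) * y
          ≈⟨ +-cong (*-congˡ ihₑ) (*-congˡ ihf) ⟩
        emptyEntry a b (suc n) ∎) ,
      (begin
        walks o full t (2 ℕ.+ k)         ≈⟨ walks-full o t (suc k) ⟩
        walks (suc o) empty t (suc k)    ≈⟨ step₁ ⟩
        (1# + m) * x + y                 ≈⟨ +-cong (*-congˡ ihₑ) ihf ⟩
        fullEntry a b (suc n)            ∎)
      where
      k : ℕ
      k = n ℕ.* 2

      a b x y : Carrier
      a = walks 0 empty t 0
      b = walks 0 full t 0
      x = walks (2 ℕ.+ o) empty t k
      y = walks (2 ℕ.+ o) full t k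

      weight-odd : weight (signℕ o) ≈ i
      weight-odd = trans (reflexive (≡.cong weight odd)) (*-identityʳ i)

      step₁ : walks (suc o) empty t (suc k) ≈ (1# + m) * x + y
      step₁ = trans (walks-empty (suc o) t k) (+-congʳ (*-congʳ (+-congˡ
        (trans (reflexive (≡.cong weight even)) (*-identityʳ m)))))

    trace : ℕ → Carrier
    trace n = emptyEntry 1# 0# n + fullEntry 0# 1# n

    τ : Carrier
    τ = # 4 - z - z⁻¹

    τ-trace : (1# + i) * (1# + m) + (1# + 1#) ≈ τ
    τ-trace = begin
      (1# + i) * (1# + m) + (1# + 1#)
        ≈⟨ solve 2 (λ i m → (con 1 :+ i) :* (con 1 :+ m) :+ (con 1 :+ con 1) :=
             (con 3 :+ m :* i) :+ m :+ i) refl i m ⟩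
      (3 ·′ 1# + m * i) + m + i
        ≈⟨ +-congʳ (+-congʳ (+-congˡ mi≈1)) ⟩
      (3 ·′ 1# + 1#) + m + i
        ≈⟨ +-congʳ (+-congʳ (#≈×′ 4)) ⟨
      τ ∎

    -- The determinant ((1+i)(1+m) + 1) - (1+i)(1+m) is 1 for any i and m, so the solver's identity
    -- is purely polynomial; m i = 1 enters only through `τ-trace`. The two diagonal entries come
    -- from different initial vectors, hence the four unknowns besides i and m.
    trace-recurrent : Recurrent τ trace
    trace-recurrent n = trans
      (solve 6 (λ i m e f e′ f′ →
        let p = con 1 :+ i
            q = con 1 :+ m
            e₁ = (p :* q :+ con 1) :* e :+ p :* f
            f₁ = q :* e :+ f
            e₁′ = (p :* q :+ con 1) :* e′ :+ p :* f′
            f₁′ = q :* e′ :+ f′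
        in (((p :* q :+ con 1) :* e₁ :+ p :* f₁) :+ (q :* e₁′ :+ f₁′)) :+ (e :+ f′)
           := (p :* q :+ (con 1 :+ con 1)) :* (e₁ :+ f₁′))
        refl i m (emptyEntry 1# 0# n) (fullEntry 1# 0# n) (emptyEntry 0# 1# n) (fullEntry 0# 1# n))
      (*-congʳ τ-trace)

    trace-1 : trace 1 ≈ τ
    trace-1 = trans (solve 2 (λ i m → let p = con 1 :+ i; q = con 1 :+ m in
        ((p :* q :+ con 1) :* con 1 :+ p :* con 0) :+ (q :* con 0 :+ con 1) := p :* q :+ (con 1 :+ con 1)) refl i m)
      τ-trace

    P-trace : ∀ n → P (suc n ℕ.* 2) ≈ trace (suc n)
    P-trace n = begin
      P (suc n ℕ.* 2)
        ≈⟨ 𝒫-contributions (suc n ℕ.* 2) ⟩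
      _ ≈⟨ ∑ⱽ-cong (suc n ℕ.* 2) closed-walks ⟩
      _ ≈⟨ ∑ⱽ-+ (suc n ℕ.* 2) (walk 1 empty empty) (walk 1 full full) ⟩
      walks 1 empty empty (suc n ℕ.* 2) + walks 1 full full (suc n ℕ.* 2)
        ≈⟨ +-cong (proj₁ (walks-double (suc n) 1 empty ≡.refl ≡.refl))
             (proj₂ (walks-double (suc n) 1 full ≡.refl ≡.refl)) ⟩
      trace (suc n) ∎

    P-0 : P 0 ≈ 1#
    P-0 = 𝒫-contributions 0

    P-2 : P 2 ≈ τ
    P-2 = trans (P-trace 0) trace-1

    P-recurrence : ∀ n → P (suc (suc (suc n)) ℕ.* 2) ≈ P 2 * P (suc (suc n) ℕ.* 2) - P (suc n ℕ.* 2)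
    P-recurrence n = x+y≈w⇒x≈w-y (trans (+-cong (P-trace (2 ℕ.+ n)) (P-trace n))
      (trans (trace-recurrent (suc n)) (sym (*-cong P-2 (P-trace (suc n))))))

    P-4 : P 4 ≈ P 2 * P 2 - # 2
    P-4 = x+y≈w⇒x≈w-y (trans (+-cong (P-trace 1) (#≈×′ 2))
      (trans (trace-recurrent 0) (sym (*-cong P-2 (P-trace 0)))))

    -- The value `g 0` is matched with `trace 0`, which is 2, and not with `P 0`; the conclusion
    -- accordingly begins with two columns.
    P-unique : ∀ {g} → Recurrent τ g → g 0 ≈ 1# + 1# → g 1 ≈ τ → ∀ n → P (suc n ℕ.* 2) ≈ g (suc n)
    P-unique {g} rec g₀ g₁ n = trans (P-trace n) (proj₂ (recurrent-unique {τ} {trace} {g} trace-recurrent rec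
      (sym g₀) (trans trace-1 (sym g₁)) n))

    -- The formula with the square root.

    module _ (s u : Carrier) (s²≈ : s * s ≈ 1# + z * (z - # 6)) (4zu≈ : - (# 4 * z) * u ≈ 1#) where
      -- Only squares of `x` and `y` matter, so they may be replaced by w + s and w + s′. The solver
      -- treats `s′` as a free variable, and `s+s′≈0` is applied by hand.
      x y w s′ : Carrier
      x = z - 1# - s
      y = z - 1# + s
      w = m + 1#
      s′ = - s

      s+s′≈0 : s + s′ ≈ 0#
      s+s′≈0 = -‿inverseʳ s

      x≈ : x ≈ - (w + s)
      x≈ = trans (+-congʳ (trans (+-congʳ (sym (neg-involutive z))) (-‿+-comm m 1#))) (-‿+-comm w s)

      y≈ : y ≈ - (w + s′)
      y≈ = trans (+-cong (trans (+-congʳ (sym (neg-involutive z))) (-‿+-comm m 1#)) (sym (neg-involutive s)))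
        (-‿+-comm w s′)

      x²≈ : x * x ≈ (w + s) * (w + s)
      x²≈ = trans (*-cong x≈ x≈) (neg-*-neg (w + s) (w + s))

      y²≈ : y * y ≈ (w + s′) * (w + s′)
      y²≈ = trans (*-cong y≈ y≈) (neg-*-neg (w + s′) (w + s′))

      s²≈′ : s * s ≈ 1# + m * (m + 6 ·′ 1#)
      s²≈′ = begin
        s * s                        ≈⟨ s²≈ ⟩
        1# + z * (z - # 6)           ≈⟨ +-congˡ (*-cong (neg-involutive z)
                                          (+-cong (neg-involutive z) (-‿cong (sym (#≈×′ 6))))) ⟨
        1# + - m * (- m - 6 ·′ 1#)   ≈⟨ +-congˡ (*-congˡ (-‿+-comm m (6 ·′ 1#))) ⟩
        1# + - m * - (m + 6 ·′ 1#)   ≈⟨ +-congˡ (neg-*-neg m (m + 6 ·′ 1#)) ⟩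
        1# + m * (m + 6 ·′ 1#)       ∎

      4mu≈1 : (4 ·′ 1#) * m * u ≈ 1#
      4mu≈1 = trans (*-congʳ (trans (*-congʳ (sym (#≈×′ 4))) (sym (-‿distribʳ-* (# 4) z)))) 4zu≈

      root-sum : u * (x * x) + u * (y * y) ≈ τ
      root-sum = begin
        u * (x * x) + u * (y * y)
          ≈⟨ +-cong (*-congˡ x²≈) (*-congˡ y²≈) ⟩
        u * ((w + s) * (w + s)) + u * ((w + s′) * (w + s′))
          ≈⟨ solve 4 (λ u w s s′ → u :* ((w :+ s) :* (w :+ s)) :+ u :* ((w :+ s′) :* (w :+ s′)) :=
               u :* (con 2 :* w :* w :+ con 2 :* w :* (s :+ s′) :+ s :* s :+ s′ :* s′)) refl u w s s′ ⟩
        u * ((2 ·′ 1#) * w * w + (2 ·′ 1#) * w * (s + s′) + s * s + s′ * s′)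
          ≈⟨ *-congˡ (+-cong (+-cong (+-congˡ (*-congˡ s+s′≈0)) s²≈′) (trans (neg-*-neg s s) s²≈′)) ⟩
        u * ((2 ·′ 1#) * w * w + (2 ·′ 1#) * w * 0# + q + q)
          ≈⟨ solve 2 (λ u m → let w = m :+ con 1; q = con 1 :+ m :* (m :+ con 6) in
               u :* (con 2 :* w :* w :+ con 2 :* w :* con 0 :+ q :+ q) :=
               (con 4 :* m :* u) :* (con 4 :+ m) :+ con 4 :* u :* con 1) refl u m ⟩
        ((4 ·′ 1#) * m * u) * (4 ·′ 1# + m) + (4 ·′ 1#) * u * 1#
          -- The term 4u lacks a factor m; writing 1 as m i lets 4mu be factored out.
          ≈⟨ +-congˡ (*-congˡ mi≈1) ⟨
        ((4 ·′ 1#) * m * u) * (4 ·′ 1# + m) + (4 ·′ 1#) * u * (m * i)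
          ≈⟨ solve 3 (λ u m i → (con 4 :* m :* u) :* (con 4 :+ m) :+ con 4 :* u :* (m :* i) :=
               (con 4 :* m :* u) :* (con 4 :+ m :+ i)) refl u m i ⟩
        ((4 ·′ 1#) * m * u) * (4 ·′ 1# + m + i)
          ≈⟨ *-cong 4mu≈1 (+-congʳ (+-congʳ (sym (#≈×′ 4)))) ⟩
        1# * τ
          ≈⟨ *-identityˡ τ ⟩
        τ ∎
        where
        q : Carrier
        q = 1# + m * (m + 6 ·′ 1#)

      -- This is w² - s² = -4m: adding 4m to w² gives s², and what remains is a multiple of s + s′.
      factors : (w + s) * (w + s′) ≈ - ((4 ·′ 1#) * m)
      factors = +-inverseˡ-unique _ _ (begin
        (w + s) * (w + s′) + (4 ·′ 1#) * m
          ≈⟨ solve 3 (λ m s s′ → let w = m :+ con 1 in (w :+ s) :* (w :+ s′) :+ con 4 :* m :=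
               (con 1 :+ m :* (m :+ con 6)) :+ w :* (s :+ s′) :+ s :* s′) refl m s s′ ⟩
        (1# + m * (m + 6 ·′ 1#)) + w * (s + s′) + s * s′
          ≈⟨ +-congʳ (+-cong (sym s²≈′) (*-congˡ s+s′≈0)) ⟩
        s * s + w * 0# + s * s′
          ≈⟨ solve 3 (λ w s s′ → s :* s :+ w :* con 0 :+ s :* s′ := s :* (s :+ s′)) refl w s s′ ⟩
        s * (s + s′)
          ≈⟨ *-congˡ s+s′≈0 ⟩
        s * 0#
          ≈⟨ zeroʳ s ⟩
        0# ∎)

      root-product : (u * (x * x)) * (u * (y * y)) ≈ 1#
      root-product = begin
        (u * (x * x)) * (u * (y * y))
          ≈⟨ *-cong (*-congˡ x²≈) (*-congˡ y²≈) ⟩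
        (u * ((w + s) * (w + s))) * (u * ((w + s′) * (w + s′)))
          ≈⟨ solve 3 (λ u a b → (u :* (a :* a)) :* (u :* (b :* b)) := (a :* b) :* (a :* b) :* (u :* u))
               refl u (w + s) (w + s′) ⟩
        ((w + s) * (w + s′)) * ((w + s) * (w + s′)) * (u * u)
          ≈⟨ *-congʳ (trans (*-cong factors factors) (neg-*-neg ((4 ·′ 1#) * m) ((4 ·′ 1#) * m))) ⟩
        ((4 ·′ 1#) * m) * ((4 ·′ 1#) * m) * (u * u)
          ≈⟨ solve 2 (λ a u → a :* a :* (u :* u) := (a :* u) :* (a :* u)) refl ((4 ·′ 1#) * m) u ⟩
        ((4 ·′ 1#) * m * u) * ((4 ·′ 1#) * m * u)
          ≈⟨ *-cong 4mu≈1 4mu≈1 ⟩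
        1# * 1#
          ≈⟨ *-identityˡ 1# ⟩
        1# ∎

      P-roots : ∀ n → P (suc n ℕ.* 2) ≈ u ^ suc n * (x ^ (suc n ℕ.* 2) + y ^ (suc n ℕ.* 2))
      P-roots n = trans
        (P-unique (powerSum-recurrent root-sum root-product) refl
          (trans (+-cong (*-identityʳ _) (*-identityʳ _)) root-sum) n)
        (trans (+-cong (scaled-^ u x (suc n)) (scaled-^ u y (suc n))) (sym (distribˡ _ _ _)))

    -- The closed form as a rescaled Lucas polynomial.

    lucas-recurrent : Recurrent τ (λ n → i ^ n * lucas (n ℕ.* 2))
    lucas-recurrent n = begin
      i * (i * iⁿ) * lucas (4 ℕ.+ k) + iⁿ * lucas k
        -- The factor (m i)² = 1 supplies the m² that `lucas-double` needs: scaling by powers of i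
        -- turns the product m² into 1 and the sum 1 + 4m + m² into `τ`.
        ≈⟨ +-congˡ (trans (*-congʳ (trans (*-cong mi≈1 mi≈1) (*-identityˡ 1#))) (*-identityˡ _)) ⟨
      i * (i * iⁿ) * lucas (4 ℕ.+ k) + ((m * i) * (m * i)) * (iⁿ * lucas k)
        ≈⟨ solve 5 (λ i m x a b → i :* (i :* x) :* a :+ ((m :* i) :* (m :* i)) :* (x :* b) :=
             i :* (i :* x) :* (a :+ m :* m :* b)) refl i m iⁿ (lucas (4 ℕ.+ k)) (lucas k) ⟩
      i * (i * iⁿ) * (lucas (4 ℕ.+ k) + m * m * lucas k)
        ≈⟨ *-congˡ (lucas-double k) ⟩
      i * (i * iⁿ) * ((1# + (4 ·′ 1#) * m + m * m) * lucas (2 ℕ.+ k))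
        ≈⟨ solve 4 (λ i m x a → i :* (i :* x) :* ((con 1 :+ con 4 :* m :+ m :* m) :* a) :=
             (con 4 :* (m :* i) :+ m :* (m :* i) :+ i) :* (i :* x :* a)) refl i m iⁿ (lucas (2 ℕ.+ k)) ⟩
      ((4 ·′ 1#) * (m * i) + m * (m * i) + i) * (i * iⁿ * lucas (2 ℕ.+ k))
        ≈⟨ *-congʳ (+-congʳ (+-cong (trans (*-congˡ mi≈1) (trans (*-identityʳ _) (sym (#≈×′ 4))))
             (trans (*-congˡ mi≈1) (*-identityʳ m)))) ⟩
      τ * (i * iⁿ * lucas (2 ℕ.+ k)) ∎
      where
      k : ℕ
      k = n ℕ.* 2
      iⁿ : Carrier
      iⁿ = i ^ n

    lucas-2 : i ^ 1 * lucas 2 ≈ τ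
    lucas-2 = begin
      i * 1# * ((1# + m) * (1# + m) + m * (1# + 1#))
        ≈⟨ solve 2 (λ i m → i :* con 1 :* ((con 1 :+ m) :* (con 1 :+ m) :+ m :* (con 1 :+ con 1)) :=
             con 4 :* (m :* i) :+ m :* (m :* i) :+ i) refl i m ⟩
      (4 ·′ 1#) * (m * i) + m * (m * i) + i
        ≈⟨ +-congʳ (+-cong (trans (*-congˡ mi≈1) (trans (*-identityʳ _) (sym (#≈×′ 4))))
             (trans (*-congˡ mi≈1) (*-identityʳ m))) ⟩
      τ ∎

    P-closed : ∀ n → P (suc n ℕ.* 2) ≈ i ^ suc n *
      (∑[ p ≤ suc n ℕ.* 2 ] ((- 1#) ^ toℕ p * z ^ toℕ p *
        (∑[ q ≤ toℕ p ] # (summand (suc n ℕ.* 2) (toℕ p) (toℕ q)))))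
    P-closed n = trans (P-unique lucas-recurrent (*-identityˡ _) lucas-2 n)
      (*-congˡ (sym (trans
        (∑≤-cong (suc n ℕ.* 2) λ p _ → *-congʳ {x = summandRow (suc n ℕ.* 2) p} (sym (neg-^ z p)))
        (closed-form-lucas (n ℕ.* 2)))))

-- The theorem for even n.

open import Data.Integer.Base using (+_)

mainTheorem5 : ∀ {c ℓ} (R : CommutativeRing c ℓ) →
    let open CommutativeRing R
        open Exp semiring using (_^_)
        open Sum semiring using (sum⁺-syntax)
        # = λ (k : ℕ) → fromℤ R (+ k)
    in
    (z z⁻¹ : Carrier) → z * z⁻¹ ≈ 1# →
    let P = 𝒫 R z z⁻¹ in
    -- the recursion; for n = 4 it holds with 2 in the place of P 0 = 1
    (∀ n → 2 ∣ n → 6 ≤ n → P n ≈ P 2 * P (n ∸ 2) - P (n ∸ 4)) ×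
    (P 4 ≈ P 2 * P 2 - # 2) ×
    -- the initial conditions
    (P 0 ≈ 1#) ×
    (P 2 ≈ # 4 - z - z⁻¹) ×
    -- the solution, with s a square root of 1 + z (z - 6), u = 1 / (- 4 z)
    (∀ s u → s * s ≈ 1# + z * (z - # 6) → (- (# 4 * z)) * u ≈ 1# →
      ∀ n → 2 ∣ n → 2 ≤ n →
      P n ≈ u ^ (n / 2) * ((z - 1# - s) ^ n + (z - 1# + s) ^ n)) ×
    -- the closed form, with prefactor (- z)^(- n / 2)
    (∀ n → 2 ∣ n → 2 ≤ n →
      P n ≈ (- z⁻¹) ^ (n / 2) *
            (∑[ p ≤ n ] ((- 1#) ^ toℕ p * z ^ toℕ p *
              (∑[ q ≤ toℕ p ] (# (summand n (toℕ p) (toℕ q)))))))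
mainTheorem5 R z z⁻¹ zz⁻¹≈1 = recurrence , P-4 , P-0 , P-2 , roots , closed
  where
  open CommutativeRing R
  open Exp semiring using (_^_)
  open Sum semiring using (sum⁺-syntax)

  open StripOfSquares.Evaluation R z z⁻¹ zz⁻¹≈1
    using (P; P-0; P-2; P-4; P-recurrence; P-roots; P-closed)

  half : ∀ n x y → x ^ n * y ≈ x ^ (n ℕ.* 2 / 2) * y
  half n x y = *-congʳ (reflexive (≡.cong (x ^_) (≡.sym (m*n/n≡m n 2))))

  recurrence : ∀ n → 2 ∣ n → 6 ≤ n → P n ≈ P 2 * P (n ∸ 2) - P (n ∸ 4)
  recurrence _ (divides 1 ≡.refl) (s≤s (s≤s ()))
  recurrence _ (divides 2 ≡.refl) (s≤s (s≤s (s≤s (s≤s ()))))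
  recurrence _ (divides (suc (suc (suc q))) ≡.refl) _ = P-recurrence q

  roots : ∀ s u → s * s ≈ 1# + z * (z - fromℤ R (+ 6)) → (- (fromℤ R (+ 4) * z)) * u ≈ 1# →
    ∀ n → 2 ∣ n → 2 ≤ n → P n ≈ u ^ (n / 2) * ((z - 1# - s) ^ n + (z - 1# + s) ^ n)
  roots s u s² 4zu _ (divides (suc q) ≡.refl) _ =
    trans (P-roots s u s² 4zu q) (half (suc q) u _)

  closed : ∀ n → 2 ∣ n → 2 ≤ n → P n ≈ (- z⁻¹) ^ (n / 2) *
    (∑[ p ≤ n ] ((- 1#) ^ toℕ p * z ^ toℕ p *
      (∑[ q ≤ toℕ p ] (fromℤ R (+ summand n (toℕ p) (toℕ q))))))
  closed _ (divides (suc q) ≡.refl) _ =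
    trans (P-closed q) (half (suc q) (- z⁻¹) _)
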